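{- For every $\lambda<1$ and every odd positive integer $D$, there exists $\lambda'<1$ (depending only on $\lambda$ and $D$) such that for every $N$, if $G$ is an $(N,D,\lambda)$-graph and $C$ is the cycle on $D$ vertices, then the replacement product of $G$ (as the large graph) with $C$ (as the small graph) is an $(ND,3,\lambda')$-graph.
   Context: For a positive integer $n$, $[n]=\{1,\dots,n\}$. Graphs are finite, undirected and regular, and may have self-loops and parallel edges. A $D$-regular graph $G$ on $[N]$ is specified by its rotation map $\mathrm{Rot}_G:[N]\times[D]\to[N]\times[D]$: $\mathrm{Rot}_G(v,i)=(w,j)$ means that the $i$-th edge incident to $v$ leads to $w$ and that this edge is the $j$-th edge incident to $w$. Thus $\mathrm{Rot}_G$ is a permutation with $\mathrm{Rot}_G\circ\mathrm{Rot}_G=\mathrm{id}$ (and any such involution specifies a $D$-regular graph). Vertex sets and sets of edge labels may be any finite sets of the right cardinality. The cycle $C$ is the 2-regular graph on $[D]$ in which $i$ is joined to $i\pm1$ modulo $D$ (with any edge labeling). The normalized adjacency matrix of $G$ is the symmetric $N\times N$ matrix with $M_{u,v}=\frac1D|\{(i,j)\in[D]^2:\mathrm{Rot}_G(u,i)=(v,j)\}|$. The second largest eigenvalue in absolute value is $\lambda(G)=\max_{\alpha\perp 1_N,\,\alpha\ne0}\|M\alpha\|/\|\alpha\|$, where $1_N$ is the all-ones vector and the norm is Euclidean (with $\lambda(G)=0$ if $N=1$). An $(N,D,\lambda)$-graph is a $D$-regular graph on $N$ vertices with $\lambda(G)\le\lambda$. Replacement product: for a $D_1$-regular graph $G_1$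 on $[N_1]$ (the large graph) and a $D_2$-regular graph $G_2$ on $[D_1]$ (the small graph), it is the $(D_2+1)$-regular graph on $[N_1]\times[D_1]$ whose rotation map on input $((v,k),i)$ is: if $i\le D_2$, let $(m,j)=\mathrm{Rot}_{G_2}(k,i)$ and output $((v,m),j)$; if $i=D_2+1$, output $(\mathrm{Rot}_{G_1}(v,k),i)$. -}

module Defs where

open import Algebra.Bundles.Raw using (RawMonoid)
import Algebra.Definitions.RawMonoid as RawMonoidDefinitions
open import Data.Bool.Base using (if_then_else_)
open import Data.Empty using (⊥-elim)
open import Data.Fin.Base using (Fin; zero; suc; toℕ; splitAt; _↑ˡ_; _↑ʳ_; combine; remQuot)
import Data.Fin.Properties as Fin
import Data.Integer.Base as ℤ
import Data.Integer.Properties as ℤ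
open import Data.Nat.Base as ℕ using (ℕ; zero; suc)
import Data.Nat.Coprimality as Coprimality
open import Data.Nat.DivMod using (_mod_)
import Data.Nat.Properties as ℕ
open import Data.Product.Base using (_×_; _,_; proj₁; proj₂; ∃)
open import Data.Product.Properties using (≡-dec)
open import Data.Rational.Base as ℚ
  using (ℚ; mkℚ; 0ℚ; 1ℚ; ½; Positive; NonNegative; positive; nonNegative; 1/_)
  renaming (_+_ to _+ℚ_; _*_ to _*ℚ_; _-_ to _-ℚ_; -_ to -ℚ_; _≤_ to _≤ℚ_; _<_ to _<ℚ_;
            _⊔_ to _⊔ℚ_; ∣_∣ to ∣_∣ℚ)
import Data.Rational.Properties as ℚ
open import Data.Rational.Solver using (module +-*-Solver)
import Data.Rational.Unnormalised.Base as ℚᵘ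
import Data.Rational.Unnormalised.Properties as ℚᵘ
open import Data.Sum.Base using (_⊎_; inj₁; inj₂; [_,_]′)
open import Data.Vec.Functional using (Vector)
open import Level using (0ℓ)
open import Relation.Binary.PropositionalEquality
  using (_≡_; refl; sym; trans; cong; cong₂; subst)
open import Relation.Nullary using (Dec; ¬_; yes; no; does)

-- Real numbers: Cauchy sequences of rationals.  Two sequences denote the same
-- real when they are related by _≃_, not only when they are equal.

Eventually : (ℕ → Set) → Set
Eventually P = ∃ λ N → ∀ n → N ℕ.≤ n → P n

Eventually₂ : (ℕ → ℕ → Set) → Set
Eventually₂ P = ∃ λ N → ∀ m n → N ℕ.≤ m → N ℕ.≤ n → P m n

IsCauchy : (ℕ → ℚ) → Set
IsCauchy x = ∀ ε → 0ℚ <ℚ ε → Eventually₂ λ m n → ∣ x m -ℚ x n ∣ℚ ≤ℚ ε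

record ℝ : Set where
  constructor mkℝ
  field
    seq    : ℕ → ℚ
    cauchy : IsCauchy seq

open ℝ public

infix 4 _≤_ _<_ _≃_

_≤_ : ℝ → ℝ → Set
x ≤ y = ∀ ε → 0ℚ <ℚ ε → Eventually λ n → seq x n ≤ℚ seq y n +ℚ ε

_<_ : ℝ → ℝ → Set
x < y = ∃ λ ε → 0ℚ <ℚ ε × Eventually λ n → seq x n +ℚ ε ≤ℚ seq y n

_≃_ : ℝ → ℝ → Set
x ≃ y = x ≤ y × y ≤ x

open ℚ.≤-Reasoning

p-p≡0 : ∀ p → p -ℚ p ≡ 0ℚ
p-p≡0 = ℚ.+-inverseʳ

half-pos : ∀ {ε} → 0ℚ <ℚ ε → 0ℚ <ℚ ½ *ℚ ε
half-pos {ε} 0<ε =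
  ℚ.positive⁻¹ (½ *ℚ ε) {{ℚ.pos*pos⇒pos ½ ε {{positive 0<ε}}}}

+-nonneg : ∀ {p q} → 0ℚ ≤ℚ p → 0ℚ ≤ℚ q → 0ℚ ≤ℚ p +ℚ q
+-nonneg {p} {q} 0≤p 0≤q = ℚ.nonNegative⁻¹ (p +ℚ q)
  {{ℚ.nonNeg+nonNeg⇒nonNeg p {{nonNegative 0≤p}} q {{nonNegative 0≤q}}}}

*-nonneg : ∀ {p q} → 0ℚ ≤ℚ p → 0ℚ ≤ℚ q → 0ℚ ≤ℚ p *ℚ q
*-nonneg {p} {q} 0≤p 0≤q = ℚ.nonNegative⁻¹ (p *ℚ q)
  {{ℚ.nonNeg*nonNeg⇒nonNeg p {{nonNegative 0≤p}} q {{nonNegative 0≤q}}}}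

+1-pos : ∀ {p} → 0ℚ ≤ℚ p → 0ℚ <ℚ p +ℚ 1ℚ
+1-pos {p} 0≤p = ℚ.positive⁻¹ (p +ℚ 1ℚ) {{ℚ.nonNeg+pos⇒pos p {{nonNegative 0≤p}} 1ℚ}}

half+half : ∀ ε → ½ *ℚ ε +ℚ ½ *ℚ ε ≡ ε
half+half = solve 1 (λ ε → con ½ :* ε :+ con ½ :* ε := ε) refl
  where open +-*-Solver

p≤∣p∣ : ∀ p → p ≤ℚ ∣ p ∣ℚ
p≤∣p∣ p with ℚ.≤-total 0ℚ p
... | inj₁ 0≤p = ℚ.≤-reflexive (sym (ℚ.0≤p⇒∣p∣≡p 0≤p))
... | inj₂ p≤0 = ℚ.≤-trans p≤0 (ℚ.0≤∣p∣ p)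

∣p∣≤-intro : ∀ {p r} → p ≤ℚ r → -ℚ p ≤ℚ r → ∣ p ∣ℚ ≤ℚ r
∣p∣≤-intro {p} p≤r -p≤r with ℚ.∣p∣≡p∨∣p∣≡-p p
... | inj₁ eq rewrite eq = p≤r
... | inj₂ eq rewrite eq = -p≤r

p-q≤r⇒p≤q+r : ∀ {p q r} → p -ℚ q ≤ℚ r → p ≤ℚ q +ℚ r
p-q≤r⇒p≤q+r {p} {q} {r} h = begin
  p             ≡⟨ solve 2 (λ p q → p := q :+ (p :- q)) refl p q ⟩
  q +ℚ (p -ℚ q) ≤⟨ ℚ.+-monoʳ-≤ q h ⟩
  q +ℚ r        ∎
  where open +-*-Solver

p≤q+r⇒p-q≤r : ∀ {p q r} → p ≤ℚ q +ℚ r → p -ℚ q ≤ℚ r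
p≤q+r⇒p-q≤r {p} {q} {r} h = begin
  p -ℚ q         ≤⟨ ℚ.+-monoˡ-≤ (-ℚ q) h ⟩
  q +ℚ r -ℚ q    ≡⟨ solve 2 (λ q r → q :+ r :- q := r) refl q r ⟩
  r              ∎
  where open +-*-Solver

∣p-q∣≤r⇒p≤q+r : ∀ {p q r} → ∣ p -ℚ q ∣ℚ ≤ℚ r → p ≤ℚ q +ℚ r
∣p-q∣≤r⇒p≤q+r {p} {q} h = p-q≤r⇒p≤q+r (ℚ.≤-trans (p≤∣p∣ (p -ℚ q)) h)

-- Since m and n range over the same tail, a one-sided bound suffices.
cauchy-onesided : ∀ (x : ℕ → ℚ) →
  (∀ ε → 0ℚ <ℚ ε → Eventually₂ λ m n → x m ≤ℚ x n +ℚ ε) → IsCauchy x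
cauchy-onesided x h ε 0<ε with h ε 0<ε
... | N , f = N , λ m n N≤m N≤n → ∣p∣≤-intro
  (p≤q+r⇒p-q≤r (f m n N≤m N≤n))
  (subst (_≤ℚ ε) (solve 2 (λ a b → b :- a := :- (a :- b)) refl (x m) (x n))
    (p≤q+r⇒p-q≤r (f n m N≤n N≤m)))
  where open +-*-Solver

both : ∀ {M N m} → M ℕ.⊔ N ℕ.≤ m → M ℕ.≤ m × N ℕ.≤ m
both {M} {N} le = ℕ.≤-trans (ℕ.m≤m⊔n M N) le , ℕ.≤-trans (ℕ.m≤n⊔m M N) le

fromℚ : ℚ → ℝ
seq    (fromℚ q) _ = q
cauchy (fromℚ q) ε 0<ε = 0 , λ _ _ _ _ →
  subst (λ p → ∣ p ∣ℚ ≤ℚ ε) (sym (p-p≡0 q)) (ℚ.<⇒≤ 0<ε)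

0ℝ 1ℝ : ℝ
0ℝ = fromℚ 0ℚ
1ℝ = fromℚ 1ℚ

infixl 6 _+_
infixl 7 _*_

_+_ : ℝ → ℝ → ℝ
seq    (x + y) n = seq x n +ℚ seq y n
cauchy (x + y) ε 0<ε with cauchy x _ (half-pos 0<ε) | cauchy y _ (half-pos 0<ε)
... | M , f | N , g = M ℕ.⊔ N , λ m n le₁ le₂ →
  let a = seq x m ; b = seq y m ; c = seq x n ; d = seq y n in begin
  ∣ a +ℚ b -ℚ (c +ℚ d) ∣ℚ       ≡⟨ cong ∣_∣ℚ (solve 4 (λ a b c d →
                                     a :+ b :- (c :+ d) := (a :- c) :+ (b :- d)) refl a b c d) ⟩
  ∣ (a -ℚ c) +ℚ (b -ℚ d) ∣ℚ     ≤⟨ ℚ.∣p+q∣≤∣p∣+∣q∣ (a -ℚ c) (b -ℚ d) ⟩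
  ∣ a -ℚ c ∣ℚ +ℚ ∣ b -ℚ d ∣ℚ    ≤⟨ ℚ.+-mono-≤
                                     (f m n (proj₁ (both {M} le₁)) (proj₁ (both {M} le₂)))
                                     (g m n (proj₂ (both {M} le₁)) (proj₂ (both {M} le₂))) ⟩
  ½ *ℚ ε +ℚ ½ *ℚ ε              ≡⟨ half+half ε ⟩
  ε                             ∎
  where open +-*-Solver

eventually-bounded : ∀ x → ∃ λ B → 0ℚ <ℚ B × Eventually λ n → ∣ seq x n ∣ℚ ≤ℚ B
eventually-bounded x with cauchy x 1ℚ (ℚ.positive⁻¹ 1ℚ)
... | N , f = ∣ c ∣ℚ +ℚ 1ℚ , 0<B , N , λ n N≤n → begin
  ∣ seq x n ∣ℚ                 ≡⟨ cong ∣_∣ℚ (solve 2 (λ c a → a := c :+ (a :- c)) refl c (seq x n)) ⟩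
  ∣ c +ℚ (seq x n -ℚ c) ∣ℚ     ≤⟨ ℚ.∣p+q∣≤∣p∣+∣q∣ c (seq x n -ℚ c) ⟩
  ∣ c ∣ℚ +ℚ ∣ seq x n -ℚ c ∣ℚ  ≤⟨ ℚ.+-monoʳ-≤ ∣ c ∣ℚ (f n N N≤n ℕ.≤-refl) ⟩
  ∣ c ∣ℚ +ℚ 1ℚ                 ∎
  where
  open +-*-Solver
  c : ℚ
  c = seq x N
  0<B : 0ℚ <ℚ ∣ c ∣ℚ +ℚ 1ℚ
  0<B = +1-pos (ℚ.0≤∣p∣ c)

divide : ∀ {ε B} → 0ℚ <ℚ ε → 0ℚ <ℚ B → ∃ λ δ → 0ℚ <ℚ δ × B *ℚ δ ≡ ε
divide {ε} {B} 0<ε 0<B = 1/B *ℚ ε , 0<δ , Bδ≡ε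
  where
  instance
    B-pos : Positive B
    B-pos = positive 0<B
    ε-pos : Positive ε
    ε-pos = positive 0<ε
    B-nonZero : ℚ.NonZero B
    B-nonZero = ℚ.pos⇒nonZero B
  1/B : ℚ
  1/B = 1/ B
  0<δ : 0ℚ <ℚ 1/B *ℚ ε
  0<δ = ℚ.positive⁻¹ (1/B *ℚ ε) {{ℚ.pos*pos⇒pos 1/B {{ℚ.1/pos⇒pos B}} ε}}
  Bδ≡ε : B *ℚ (1/B *ℚ ε) ≡ ε
  Bδ≡ε = trans (sym (ℚ.*-assoc B 1/B ε))
         (trans (cong (_*ℚ ε) (ℚ.*-inverseʳ B)) (ℚ.*-identityˡ ε))

*-mono-≤ : ∀ {p q r s} → 0ℚ ≤ℚ p → 0ℚ ≤ℚ s → p ≤ℚ q → r ≤ℚ s → p *ℚ r ≤ℚ q *ℚ s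
*-mono-≤ {p} {q} {r} {s} 0≤p 0≤s p≤q r≤s = ℚ.≤-trans
  (ℚ.*-monoˡ-≤-nonNeg p {{nonNegative 0≤p}} r≤s)
  (ℚ.*-monoʳ-≤-nonNeg s {{nonNegative 0≤s}} p≤q)

product-close : ∀ {a b c d A B δ η} → 0ℚ ≤ℚ δ → 0ℚ ≤ℚ η →
  ∣ a ∣ℚ ≤ℚ A → ∣ d ∣ℚ ≤ℚ B → ∣ b -ℚ d ∣ℚ ≤ℚ δ → ∣ a -ℚ c ∣ℚ ≤ℚ η →
  ∣ a *ℚ b -ℚ c *ℚ d ∣ℚ ≤ℚ A *ℚ δ +ℚ B *ℚ η
product-close {a} {b} {c} {d} {A} {B} {δ} {η} 0≤δ 0≤η a≤A d≤B b-d a-c = begin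
  ∣ a *ℚ b -ℚ c *ℚ d ∣ℚ                      ≡⟨ cong ∣_∣ℚ split ⟩
  ∣ a *ℚ (b -ℚ d) +ℚ d *ℚ (a -ℚ c) ∣ℚ        ≤⟨ ℚ.∣p+q∣≤∣p∣+∣q∣ (a *ℚ (b -ℚ d)) (d *ℚ (a -ℚ c)) ⟩
  ∣ a *ℚ (b -ℚ d) ∣ℚ +ℚ ∣ d *ℚ (a -ℚ c) ∣ℚ   ≡⟨ cong₂ _+ℚ_ (ℚ.∣p*q∣≡∣p∣*∣q∣ a (b -ℚ d))
                                                          (ℚ.∣p*q∣≡∣p∣*∣q∣ d (a -ℚ c)) ⟩
  ∣ a ∣ℚ *ℚ ∣ b -ℚ d ∣ℚ +ℚ ∣ d ∣ℚ *ℚ ∣ a -ℚ c ∣ℚ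
                                             ≤⟨ ℚ.+-mono-≤ (*-mono-≤ (ℚ.0≤∣p∣ a) 0≤δ a≤A b-d)
                                                           (*-mono-≤ (ℚ.0≤∣p∣ d) 0≤η d≤B a-c) ⟩
  A *ℚ δ +ℚ B *ℚ η                           ∎
  where
  open +-*-Solver
  split : a *ℚ b -ℚ c *ℚ d ≡ a *ℚ (b -ℚ d) +ℚ d *ℚ (a -ℚ c)
  split = solve 4 (λ a b c d → a :* b :- c :* d := a :* (b :- d) :+ d :* (a :- c)) refl a b c d

*-cauchy : ∀ x y → IsCauchy λ n → seq x n *ℚ seq y n
*-cauchy x y ε 0<ε =
  let A , 0<A , K , bx = eventually-bounded x
      B , 0<B , L , by = eventually-bounded y
      δ , 0<δ , Aδ≡ = divide (half-pos 0<ε) 0<A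
      η , 0<η , Bη≡ = divide (half-pos 0<ε) 0<B
      M , f = cauchy x η 0<η
      N , g = cauchy y δ 0<δ
  in (K ℕ.⊔ L) ℕ.⊔ (M ℕ.⊔ N) , λ m n le₁ le₂ →
    let KL₁ , MN₁ = both {K ℕ.⊔ L} le₁
        KL₂ , MN₂ = both {K ℕ.⊔ L} le₂
        K₁ , _  = both {K} KL₁
        _  , L₂ = both {K} KL₂
        M₁ , N₁ = both {M} MN₁
        M₂ , N₂ = both {M} MN₂
    in ℚ.≤-trans
      (product-close (ℚ.<⇒≤ 0<δ) (ℚ.<⇒≤ 0<η) (bx m K₁) (by n L₂) (g m n N₁ N₂) (f m n M₁ M₂))
      (ℚ.≤-reflexive (trans (cong₂ _+ℚ_ Aδ≡ Bη≡) (half+half ε)))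

_*_ : ℝ → ℝ → ℝ
seq    (x * y) n = seq x n *ℚ seq y n
cauchy (x * y)   = *-cauchy x y

-- Square roots of rationals by bisection: for q ≥ 0,
-- lower q n ² ≤ q < (lower q n + width q n)².

width : ℚ → ℕ → ℚ
width q zero    = q +ℚ 1ℚ
width q (suc n) = ½ *ℚ width q n

pick : ∀ {P : Set} → Dec P → ℚ → ℚ → ℚ
pick d p q = if does d then p else q

pick-elim : ∀ {P : Set} (Q : ℚ → Set) (d : Dec P) {p q : ℚ} → (P → Q p) → (¬ P → Q q) → Q (pick d p q)
pick-elim Q (yes h) f g = f h
pick-elim Q (no h)  f g = g h

mid lower : ℚ → ℕ → ℚ
mid q n = lower q n +ℚ width q (suc n)
lower q zero    = 0ℚ
lower q (suc n) = pick (mid q n *ℚ mid q n ℚ.≤? q) (mid q n) (lower q n)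

width-pos : ∀ {q} → 0ℚ ≤ℚ q → ∀ n → 0ℚ <ℚ width q n
width-pos 0≤q zero    = +1-pos 0≤q
width-pos 0≤q (suc n) = half-pos (width-pos 0≤q n)

lower-nonneg : ∀ {q} → 0ℚ ≤ℚ q → ∀ n → 0ℚ ≤ℚ lower q n
lower-nonneg {q} 0≤q zero    = ℚ.≤-refl
lower-nonneg {q} 0≤q (suc n) = pick-elim (0ℚ ≤ℚ_) (mid q n *ℚ mid q n ℚ.≤? q) {mid q n} {lower q n}
  (λ _ → +-nonneg {lower q n} {width q (suc n)}
           (lower-nonneg 0≤q n) (ℚ.<⇒≤ (width-pos 0≤q (suc n))))
  (λ _ → lower-nonneg 0≤q n)

lower² : ∀ {q} → 0ℚ ≤ℚ q → ∀ n → lower q n *ℚ lower q n ≤ℚ q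
lower² {q} 0≤q zero    = 0≤q
lower² {q} 0≤q (suc n) = pick-elim (λ l → l *ℚ l ≤ℚ q) (mid q n *ℚ mid q n ℚ.≤? q) {mid q n} {lower q n}
  (λ h → h) (λ _ → lower² 0≤q n)

upper² : ∀ {q} → 0ℚ ≤ℚ q → ∀ n →
  q <ℚ (lower q n +ℚ width q n) *ℚ (lower q n +ℚ width q n)
upper² {q} 0≤q zero = begin-strict
  q                                          ≡⟨ sym (ℚ.+-identityʳ q) ⟩
  q +ℚ 0ℚ                                    <⟨ ℚ.+-monoʳ-< q (+1-pos (+-nonneg (*-nonneg 0≤q 0≤q) 0≤q)) ⟩
  q +ℚ (q *ℚ q +ℚ q +ℚ 1ℚ)                   ≡⟨ expand q ⟩
  (0ℚ +ℚ (q +ℚ 1ℚ)) *ℚ (0ℚ +ℚ (q +ℚ 1ℚ))     ∎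
  where
  expand : ∀ q → q +ℚ (q *ℚ q +ℚ q +ℚ 1ℚ) ≡ (0ℚ +ℚ (q +ℚ 1ℚ)) *ℚ (0ℚ +ℚ (q +ℚ 1ℚ))
  expand = solve 1 (λ q → q :+ (q :* q :+ q :+ con 1ℚ) :=
    (con 0ℚ :+ (q :+ con 1ℚ)) :* (con 0ℚ :+ (q :+ con 1ℚ))) refl
    where open +-*-Solver
upper² {q} 0≤q (suc n) = pick-elim
  (λ l → q <ℚ (l +ℚ width q (suc n)) *ℚ (l +ℚ width q (suc n))) (mid q n *ℚ mid q n ℚ.≤? q) {mid q n} {lower q n}
  (λ _ → subst (λ s → q <ℚ s *ℚ s) (halve (lower q n) (width q n)) (upper² 0≤q n))
  ℚ.≰⇒>
  where
  halve : ∀ l w → l +ℚ w ≡ l +ℚ ½ *ℚ w +ℚ ½ *ℚ w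
  halve l w = trans (cong (l +ℚ_) (sym (half+half w))) (sym (ℚ.+-assoc l (½ *ℚ w) (½ *ℚ w)))

square-cancel-≤ : ∀ {u v} → 0ℚ ≤ℚ v → u *ℚ u ≤ℚ v *ℚ v → u ≤ℚ v
square-cancel-≤ {u} {v} 0≤v u²≤v² with u ℚ.≤? v
... | yes u≤v = u≤v
... | no  u≰v = ⊥-elim (ℚ.<-irrefl refl (ℚ.<-≤-trans v²<u² u²≤v²))
  where
  v<u : v <ℚ u
  v<u = ℚ.≰⇒> u≰v
  v²<u² : v *ℚ v <ℚ u *ℚ u
  v²<u² = ℚ.≤-<-trans
    (ℚ.*-monoˡ-≤-nonNeg v {{nonNegative 0≤v}} (ℚ.<⇒≤ v<u))
    (ℚ.*-monoˡ-<-pos u {{positive (ℚ.≤-<-trans 0≤v v<u)}} v<u)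

fromℕ : ℕ → ℚ
fromℕ k = mkℚ (ℤ.+ k) 0 (Coprimality.sym (Coprimality.1-coprimeTo k))

fromℕ-suc : ∀ k → fromℕ (suc k) ≡ 1ℚ +ℚ fromℕ k
fromℕ-suc k = ℚ.toℚᵘ-injective (ℚᵘ.≃-trans eq (ℚᵘ.≃-sym (ℚ.toℚᵘ-homo-+ 1ℚ (fromℕ k))))
  where
  eq : ℚ.toℚᵘ (fromℕ (suc k)) ℚᵘ.≃ ℚᵘ.1ℚᵘ ℚᵘ.+ ℚ.toℚᵘ (fromℕ k)
  eq = ℚᵘ.*≡* (cong (λ z → (ℤ.+ 1 ℤ.+ z) ℤ.* ℤ.+ 1) (sym (ℤ.*-identityʳ (ℤ.+ k))))

archimedean : ∀ q → ∃ λ k → q ≤ℚ fromℕ k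
archimedean (mkℚ (ℤ.+ k) d _) = k , ℚ.*≤*
  (ℤ.*-monoˡ-≤-nonNeg (ℤ.+ k) {ℤ.+ 1} {ℤ.+ suc d} (ℤ.+≤+ (ℕ.s≤s ℕ.z≤n)))
archimedean (mkℚ ℤ.-[1+ k ] d _) = 0 , ℚ.*≤* ℤ.-≤+

-- Bisection widths tend to 0 uniformly for bounded q.
width-small : ∀ B ε → 0ℚ <ℚ B → 0ℚ <ℚ ε →
  ∃ λ N → ∀ q → 0ℚ ≤ℚ q → q ≤ℚ B → ∀ n → N ℕ.≤ n → width q n ≤ℚ ε
width-small B ε 0<B 0<ε = k , scaled
  where
  C : ℚ
  C = B +ℚ 1ℚ
  0<C : 0ℚ <ℚ C
  0<C = +1-pos (ℚ.<⇒≤ 0<B)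
  r : ℚ
  r = proj₁ (divide 0<C 0<ε)
  εr≡C : ε *ℚ r ≡ C
  εr≡C = proj₂ (proj₂ (divide 0<C 0<ε))
  k : ℕ
  k = proj₁ (archimedean r)

  shrink : ∀ q → 0ℚ ≤ℚ q → ∀ n → fromℕ (suc n) *ℚ width q n ≤ℚ q +ℚ 1ℚ
  shrink q 0≤q zero = ℚ.≤-reflexive (ℚ.*-identityˡ (q +ℚ 1ℚ))
  shrink q 0≤q (suc n) = begin
    fromℕ (suc (suc n)) *ℚ (½ *ℚ w)              ≡⟨ cong (_*ℚ (½ *ℚ w)) (fromℕ-suc (suc n)) ⟩
    (1ℚ +ℚ t) *ℚ (½ *ℚ w)                        ≤⟨ ℚ.*-monoʳ-≤-nonNeg (½ *ℚ w)
                                                      {{nonNegative (ℚ.<⇒≤ (half-pos 0<w))}}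
                                                      (ℚ.+-monoˡ-≤ t 1≤t) ⟩
    (t +ℚ t) *ℚ (½ *ℚ w)                         ≡⟨ solve 2 (λ t w → (t :+ t) :* (con ½ :* w) := t :* w)
                                                      refl t w ⟩
    t *ℚ w                                       ≤⟨ shrink q 0≤q n ⟩
    q +ℚ 1ℚ                                      ∎
    where
    open +-*-Solver
    w t : ℚ
    w = width q n
    t = fromℕ (suc n)
    0<w : 0ℚ <ℚ w
    0<w = width-pos 0≤q n
    1≤t : 1ℚ ≤ℚ t
    1≤t = ℚ.*≤* (ℤ.*-monoʳ-≤-nonNeg (ℤ.+ 1) {ℤ.+ 1} {ℤ.+ suc n} (ℤ.+≤+ (ℕ.s≤s ℕ.z≤n)))

  scaled : ∀ q → 0ℚ ≤ℚ q → q ≤ℚ B → ∀ n → k ℕ.≤ n → width q n ≤ℚ ε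
  scaled q 0≤q q≤B n k≤n = ℚ.*-cancelˡ-≤-pos t (begin
    t *ℚ width q n      ≤⟨ shrink q 0≤q n ⟩
    q +ℚ 1ℚ             ≤⟨ ℚ.+-monoˡ-≤ 1ℚ q≤B ⟩
    C                   ≡⟨ sym εr≡C ⟩
    ε *ℚ r              ≡⟨ ℚ.*-comm ε r ⟩
    r *ℚ ε              ≤⟨ ℚ.*-monoʳ-≤-nonNeg ε {{nonNegative (ℚ.<⇒≤ 0<ε)}} r≤t ⟩
    t *ℚ ε              ∎)
    where
    t : ℚ
    t = fromℕ (suc n)
    r≤t : r ≤ℚ t
    r≤t = ℚ.≤-trans (proj₂ (archimedean r))
      (ℚ.*≤* (ℤ.*-monoʳ-≤-nonNeg (ℤ.+ 1) {ℤ.+ k} {ℤ.+ suc n}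
        (ℤ.+≤+ (ℕ.≤-trans k≤n (ℕ.n≤1+n n)))))

clip : ℚ → ℚ
clip q = q ⊔ℚ 0ℚ

clip-nonneg : ∀ q → 0ℚ ≤ℚ clip q
clip-nonneg q = ℚ.p≤q⊔p q 0ℚ

clip-mono : ∀ {p q ε} → 0ℚ ≤ℚ ε → p ≤ℚ q +ℚ ε → clip p ≤ℚ clip q +ℚ ε
clip-mono {p} {q} {ε} 0≤ε h = ℚ.⊔-lub
  (ℚ.≤-trans h (ℚ.+-monoˡ-≤ ε (ℚ.p≤p⊔q q 0ℚ)))
  (+-nonneg (clip-nonneg q) 0≤ε)

clip≤∣∣ : ∀ q → clip q ≤ℚ ∣ q ∣ℚ
clip≤∣∣ q = ℚ.⊔-lub (p≤∣p∣ q) (ℚ.0≤∣p∣ q)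

lower-close : ∀ {a b δ} → 0ℚ ≤ℚ a → 0ℚ ≤ℚ b → 0ℚ ≤ℚ δ → a ≤ℚ b +ℚ δ *ℚ δ →
  ∀ m n → lower a m ≤ℚ lower b n +ℚ width b n +ℚ δ
lower-close {a} {b} {δ} 0≤a 0≤b 0≤δ a≤b+δ² m n = square-cancel-≤ (+-nonneg 0≤s 0≤δ) (begin
  lower a m *ℚ lower a m                   ≤⟨ lower² 0≤a m ⟩
  a                                        ≤⟨ a≤b+δ² ⟩
  b +ℚ δ *ℚ δ                              ≤⟨ ℚ.+-monoˡ-≤ (δ *ℚ δ) (ℚ.<⇒≤ (upper² 0≤b n)) ⟩
  s *ℚ s +ℚ δ *ℚ δ                         ≡⟨ sym (ℚ.+-identityʳ (s *ℚ s +ℚ δ *ℚ δ)) ⟩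
  s *ℚ s +ℚ δ *ℚ δ +ℚ 0ℚ                   ≤⟨ ℚ.+-monoʳ-≤ (s *ℚ s +ℚ δ *ℚ δ)
                                                (+-nonneg 0≤sδ 0≤sδ) ⟩
  s *ℚ s +ℚ δ *ℚ δ +ℚ (s *ℚ δ +ℚ s *ℚ δ)   ≡⟨ expand s δ ⟩
  (s +ℚ δ) *ℚ (s +ℚ δ)                     ∎)
  where
  s : ℚ
  s = lower b n +ℚ width b n
  0≤s : 0ℚ ≤ℚ s
  0≤s = +-nonneg (lower-nonneg 0≤b n) (ℚ.<⇒≤ (width-pos 0≤b n))
  0≤sδ : 0ℚ ≤ℚ s *ℚ δ
  0≤sδ = *-nonneg 0≤s 0≤δ
  expand : ∀ s δ → s *ℚ s +ℚ δ *ℚ δ +ℚ (s *ℚ δ +ℚ s *ℚ δ) ≡ (s +ℚ δ) *ℚ (s +ℚ δ)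
  expand = solve 2 (λ s δ → s :* s :+ δ :* δ :+ (s :* δ :+ s :* δ) := (s :+ δ) :* (s :+ δ)) refl
    where open +-*-Solver

√-cauchy : ∀ x → IsCauchy λ n → lower (clip (seq x n)) n
√-cauchy x = cauchy-onesided _ λ ε 0<ε →
  let δ = ½ *ℚ ε
      0<δ = half-pos 0<ε
      0<δ² = ℚ.positive⁻¹ (δ *ℚ δ) {{ℚ.pos*pos⇒pos δ {{positive 0<δ}} δ {{positive 0<δ}}}}
      B , 0<B , K , bx = eventually-bounded x
      L , small = width-small B δ 0<B 0<δ
      M , f = cauchy x (δ *ℚ δ) 0<δ²
  in (K ℕ.⊔ L) ℕ.⊔ M , λ m n le₁ le₂ →
    let KL₂ , M₂ = both {K ℕ.⊔ L} le₂
        K₂ , L₂ = both {K} KL₂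
        _ , M₁ = both {K ℕ.⊔ L} le₁
        b = clip (seq x n)
        w≤δ = small b (clip-nonneg (seq x n)) (ℚ.≤-trans (clip≤∣∣ (seq x n)) (bx n K₂)) n L₂
        close = lower-close (clip-nonneg (seq x m)) (clip-nonneg (seq x n)) (ℚ.<⇒≤ 0<δ)
                  (clip-mono {seq x m} {seq x n} (ℚ.<⇒≤ 0<δ²)
                    (∣p-q∣≤r⇒p≤q+r {seq x m} {seq x n} (f m n M₁ M₂))) m n
    in ℚ.≤-trans close (ℚ.≤-trans (ℚ.+-monoˡ-≤ δ (ℚ.+-monoʳ-≤ (lower b n) w≤δ))
         (ℚ.≤-reflexive (trans (ℚ.+-assoc (lower b n) δ δ) (cong (lower b n +ℚ_) (half+half ε)))))

-- The square root of max(x, 0).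
√_ : ℝ → ℝ
seq    (√ x) n = lower (clip (seq x n)) n
cauchy (√ x)   = √-cauchy x

+-0-rawMonoid : RawMonoid 0ℓ 0ℓ
+-0-rawMonoid = record { Carrier = ℝ ; _≈_ = _≃_ ; _∙_ = _+_ ; ε = 0ℝ }

open RawMonoidDefinitions +-0-rawMonoid public using (sum)

_·_ : ∀ {N} → Vector ℝ N → Vector ℝ N → ℝ
α · β = sum λ v → α v * β v

‖_‖ : ∀ {N} → Vector ℝ N → ℝ
‖ α ‖ = √ (α · α)

𝟙 𝟘 : ∀ {N} → Vector ℝ N
𝟙 _ = 1ℝ
𝟘 _ = 0ℝ

_≋_ : ∀ {N} → Vector ℝ N → Vector ℝ N → Set
α ≋ β = ∀ v → α v ≃ β v

Matrix : ℕ → Set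
Matrix N = Fin N → Fin N → ℝ

_*ᵥ_ : ∀ {N} → Matrix N → Vector ℝ N → Vector ℝ N
(M *ᵥ α) u = sum λ v → M u v * α v

-- Regular graphs, given by their rotation maps.  Labels are counted from 0.

record Graph (N D : ℕ) : Set where
  field
    rot        : Fin N × Fin D → Fin N × Fin D
    involutive : ∀ p → rot (rot p) ≡ p

open Graph public

neighbour : ∀ {N D} → Graph N D → Fin N → Fin D → Fin N
neighbour G v i = proj₁ (rot G (v , i))

sumℕ : ∀ {n} → Vector ℕ n → ℕ
sumℕ = RawMonoidDefinitions.sum ℕ.+-0-rawMonoid

-- |{ (i , j) : rot (u , i) = (v , j) }|
edgeCount : ∀ {N D} → Graph N D → Fin N → Fin N → ℕ
edgeCount G u v = sumℕ λ i → sumℕ λ j →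
  if does (≡-dec Fin._≟_ Fin._≟_ (rot G (u , i)) (v , j)) then 1 else 0

adjacency : ∀ {N D} .{{_ : ℕ.NonZero D}} → Graph N D → Matrix N
adjacency {D = D} G u v = fromℚ (ℤ.+ edgeCount G u v ℚ./ D)

-- λ(G) ≤ ℓ.  For N ≠ 1 it says that ℓ is an upper bound of the ratios
-- ‖ M α ‖ / ‖ α ‖ whose maximum is λ(G), with the denominator cleared;
-- for N = 1 there are no such α, and λ(G) is 0.
record IsExpander {N D} .{{_ : ℕ.NonZero D}} (G : Graph N D) (ℓ : ℝ) : Set where
  field
    one-vertex : N ≡ 1 → 0ℝ ≤ ℓ
    bound      : ∀ (α : Vector ℝ N) → α · 𝟙 ≃ 0ℝ → ¬ (α ≋ 𝟘) →
                 ‖ adjacency G *ᵥ α ‖ ≤ ℓ * ‖ α ‖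

open IsExpander public

-- Each vertex may list its two neighbours in either order.
IsCycle : ∀ {D} .{{_ : ℕ.NonZero D}} → Graph D 2 → Set
IsCycle {D} C = ∀ i →
  (neighbour C i zero ≡ next i × neighbour C i (suc zero) ≡ prev i) ⊎
  (neighbour C i zero ≡ prev i × neighbour C i (suc zero) ≡ next i)
  where
  next prev : Fin D → Fin D
  next i = (toℕ i ℕ.+ 1) mod D
  prev i = (toℕ i ℕ.+ (D ℕ.∸ 1)) mod D

-- The vertex (v , k) is encoded as combine v k, and the last of the D₂ + 1 labels
-- is the edge coming from G₁.
module _ {N₁ D₁ D₂} (G₁ : Graph N₁ D₁) (G₂ : Graph D₁ D₂) where

  replacementRot : (Fin N₁ × Fin D₁) × (Fin D₂ ⊎ Fin 1) → (Fin N₁ × Fin D₁) × (Fin D₂ ⊎ Fin 1)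
  replacementRot ((v , k) , inj₁ i) = (v , proj₁ (rot G₂ (k , i))) , inj₁ (proj₂ (rot G₂ (k , i)))
  replacementRot ((v , k) , inj₂ z) = rot G₁ (v , k) , inj₂ z

  replacementRot-involutive : ∀ p → replacementRot (replacementRot p) ≡ p
  replacementRot-involutive ((v , k) , inj₁ i) =
    cong (λ (m , j) → (v , m) , inj₁ j) (involutive G₂ (k , i))
  replacementRot-involutive ((v , k) , inj₂ z) = cong (_, inj₂ z) (involutive G₁ (v , k))

  encode : (Fin N₁ × Fin D₁) × (Fin D₂ ⊎ Fin 1) → Fin (N₁ ℕ.* D₁) × Fin (D₂ ℕ.+ 1)
  encode ((v , k) , i) = combine v k , [ _↑ˡ 1 , D₂ ↑ʳ_ ]′ i

  decode : Fin (N₁ ℕ.* D₁) × Fin (D₂ ℕ.+ 1) → (Fin N₁ × Fin D₁) × (Fin D₂ ⊎ Fin 1)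
  decode (w , i) = remQuot D₁ w , splitAt D₂ i

  encode-decode : ∀ p → encode (decode p) ≡ p
  encode-decode (w , i) = cong₂ _,_ (Fin.combine-remQuot {N₁} D₁ w) (Fin.join-splitAt D₂ 1 i)

  decode-encode : ∀ p → decode (encode p) ≡ p
  decode-encode ((v , k) , i) = cong₂ _,_ (Fin.remQuot-combine v k) (Fin.splitAt-join D₂ 1 i)

  replacementProduct : Graph (N₁ ℕ.* D₁) (D₂ ℕ.+ 1)
  rot        replacementProduct p = encode (replacementRot (decode p))
  involutive replacementProduct p
    rewrite decode-encode (replacementRot (decode p))
          | replacementRot-involutive (decode p) = encode-decode p

{-# OPTIONS --safe #-}

-- For a cubic graph H with normalized adjacency matrix M, the identity
--   9 ((x + y + z) / 3)² = 3 (x² + y² + z²) − ((x − y)² + (x − z)² + (y − z)²),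
-- summed over the neighbours of all vertices, gives 9 ‖M a‖² = 9 ‖a‖² − E(a), where the energy
-- E(a) collects the squared differences of a over pairs of neighbours of a common vertex.  It
-- remains to bound ‖a‖² by a multiple of E(a) when a sums to zero and H is the replacement product.
-- The two cycle neighbours of (v , k) are (v , k ± 1).  As D is odd, steps of length two connect the
-- cycle, so E(a) controls the deviation of a from its mean on every cloud {v} × [D].  Comparing a
-- cycle neighbour with the neighbour across the edge of G then controls the Dirichlet form of the
-- function of cloud totals on G, and the spectral gap of G bounds the norm of that function.
--
-- All of this takes place over ℚ, where the order is decidable.  A real vector is replaced by its
-- n-th rational approximations, which sum to zero only in the limit; this is why the estimates
-- carry an error term sq (∑ a).

module Submission where

open import Defs
open import Data.Nat.Base using (ℕ; NonZero)
open import Data.Nat.Divisibility using (_∣_)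
open import Data.Product.Base using (∃; _×_)
open import Relation.Nullary using (¬_)

open import Algebra.Bundles using (CommutativeRing)
open import Data.Bool.Base using (if_then_else_)
open import Data.Fin.Base using (Fin; zero; suc; toℕ; _↑ˡ_; _↑ʳ_; combine; remQuot; splitAt)
open import Data.Fin.Patterns using (0F; 1F; 2F)
open import Data.Fin.Permutation using (permutation)
import Data.Fin.Properties as Fin
import Data.Integer.Base as ℤ
import Data.Integer.Properties as ℤ
open import Data.Nat.Base as ℕ using (zero; suc)
open import Data.Nat.DivMod
  using (_mod_; _%_; _/_; m≡m%n+[m/n]*n; m%n<n; m<n⇒m%n≡m; m%n%n≡m%n; %-distribˡ-+; [m+n]%n≡m%n)
import Data.Nat.Divisibility as ℕ
import Data.Nat.Properties as ℕ
open import Data.Product.Base using (_,_; proj₁; proj₂)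
open import Data.Product.Properties using (≡-dec)
open import Data.Rational.Base as ℚ
  using (ℚ; 0ℚ; 1ℚ; ½; nonNegative)
  renaming (_+_ to _+ℚ_; _*_ to _*ℚ_; _-_ to _-ℚ_; -_ to -ℚ_; _≤_ to _≤ℚ_; _<_ to _<ℚ_)
import Data.Rational.Properties as ℚ
import Data.Rational.Unnormalised.Base as ℚᵘ
import Data.Rational.Unnormalised.Properties as ℚᵘ
open import Data.Rational.Solver using (module +-*-Solver)
open import Data.Sum.Base using (inj₁; inj₂; [_,_]′)
open import Function.Base using (_∘_)
open import Relation.Binary.PropositionalEquality
  using (_≡_; _≢_; refl; sym; trans; cong; cong₂; subst; module ≡-Reasoning)
open import Relation.Nullary using (Dec; does; contradiction)
open import Relation.Nullary.Decidable using (dec-true; dec-false; decidable-stable)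

open import Algebra.Properties.Semiring.Sum (CommutativeRing.semiring ℚ.+-*-commutativeRing)
  using (sum-cong-≗; ∑-distrib-+; ∑-comm; sum-permute; sum-syntax; sum-replicate-zero; *-distribˡ-sum; *-distribʳ-sum)
  renaming (sum to ∑)

-- Rational arithmetic

sq : ℚ → ℚ
sq x = x *ℚ x

-- Reduces an inequality to a polynomial identity for the ring solver, once a visibly nonnegative
-- slack `r` is named.
≤-by-difference : ∀ {p q} r → 0ℚ ≤ℚ r → p +ℚ r ≡ q → p ≤ℚ q
≤-by-difference {p} r 0≤r refl = ℚ.≤-trans (ℚ.≤-reflexive (sym (ℚ.+-identityʳ p))) (ℚ.+-monoʳ-≤ p 0≤r)

sq-nonneg : ∀ x → 0ℚ ≤ℚ sq x
sq-nonneg x with ℚ.≤-total 0ℚ x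
... | inj₁ 0≤x = *-nonneg 0≤x 0≤x
... | inj₂ x≤0 = ℚ.≤-trans (*-nonneg 0≤-x 0≤-x)
  (ℚ.≤-reflexive (solve 1 (λ x → (:- x) :* (:- x) := x :* x) refl x))
  where
  open +-*-Solver
  0≤-x : 0ℚ ≤ℚ -ℚ x
  0≤-x = ℚ.neg-antimono-≤ x≤0

sq-+ : ∀ x y → sq (x +ℚ y) ≤ℚ fromℕ 2 *ℚ (sq x +ℚ sq y)
sq-+ x y = ≤-by-difference (sq (x -ℚ y)) (sq-nonneg (x -ℚ y))
  (solve 2 (λ x y → (x :+ y) :* (x :+ y) :+ (x :- y) :* (x :- y)
     := con (fromℕ 2) :* (x :* x :+ y :* y)) refl x y)
  where open +-*-Solver

sq-+₃ : ∀ x y z → sq (x +ℚ y +ℚ z) ≤ℚ fromℕ 3 *ℚ (sq x +ℚ sq y +ℚ sq z)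
sq-+₃ x y z = ≤-by-difference (sq (x -ℚ y) +ℚ sq (y -ℚ z) +ℚ sq (x -ℚ z))
  (+-nonneg (+-nonneg (sq-nonneg (x -ℚ y)) (sq-nonneg (y -ℚ z))) (sq-nonneg (x -ℚ z)))
  (solve 3 (λ x y z → (x :+ y :+ z) :* (x :+ y :+ z)
       :+ ((x :- y) :* (x :- y) :+ (y :- z) :* (y :- z) :+ (x :- z) :* (x :- z))
     := con (fromℕ 3) :* (x :* x :+ y :* y :+ z :* z)) refl x y z)
  where open +-*-Solver

*-monoˡ-≤ : ∀ {r p q} → 0ℚ ≤ℚ r → p ≤ℚ q → r *ℚ p ≤ℚ r *ℚ q
*-monoˡ-≤ {r} 0≤r = ℚ.*-monoˡ-≤-nonNeg r {{nonNegative 0≤r}}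

*-monoʳ-≤ : ∀ {r p q} → 0ℚ ≤ℚ r → p ≤ℚ q → p *ℚ r ≤ℚ q *ℚ r
*-monoʳ-≤ {r} 0≤r = ℚ.*-monoʳ-≤-nonNeg r {{nonNegative 0≤r}}

fromℕ-nonneg : ∀ n → 0ℚ ≤ℚ fromℕ n
fromℕ-nonneg n = ℚ.nonNegative⁻¹ (fromℕ n)

fromℕ-+ : ∀ m n → fromℕ (m ℕ.+ n) ≡ fromℕ m +ℚ fromℕ n
fromℕ-+ zero    n = sym (ℚ.+-identityˡ (fromℕ n))
fromℕ-+ (suc m) n = begin
  fromℕ (suc (m ℕ.+ n))          ≡⟨ fromℕ-suc (m ℕ.+ n) ⟩
  1ℚ +ℚ fromℕ (m ℕ.+ n)          ≡⟨ cong (1ℚ +ℚ_) (fromℕ-+ m n) ⟩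
  1ℚ +ℚ (fromℕ m +ℚ fromℕ n)     ≡⟨ ℚ.+-assoc 1ℚ (fromℕ m) (fromℕ n) ⟨
  1ℚ +ℚ fromℕ m +ℚ fromℕ n       ≡⟨ cong (_+ℚ fromℕ n) (fromℕ-suc m) ⟨
  fromℕ (suc m) +ℚ fromℕ n       ∎
  where open ≡-Reasoning

1≤fromℕ : ∀ n .{{_ : NonZero n}} → 1ℚ ≤ℚ fromℕ n
1≤fromℕ (suc n) = ≤-by-difference (fromℕ n) (fromℕ-nonneg n) (sym (fromℕ-suc n))

-- Finite sums of rationals

∑-mono : ∀ {n} {f g : Fin n → ℚ} → (∀ i → f i ≤ℚ g i) → ∑ f ≤ℚ ∑ g
∑-mono {zero}  f≤g = ℚ.≤-refl
∑-mono {suc n} f≤g = ℚ.+-mono-≤ (f≤g zero) (∑-mono (f≤g ∘ suc))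

∑-nonneg : ∀ {n} {f : Fin n → ℚ} → (∀ i → 0ℚ ≤ℚ f i) → 0ℚ ≤ℚ ∑ f
∑-nonneg {n} 0≤f = ℚ.≤-trans (ℚ.≤-reflexive (sym (sum-replicate-zero n))) (∑-mono 0≤f)

term≤∑ : ∀ {n} {f : Fin n → ℚ} → (∀ i → 0ℚ ≤ℚ f i) → ∀ i → f i ≤ℚ ∑ f
term≤∑ {suc n} 0≤f zero    = ≤-by-difference _ (∑-nonneg (0≤f ∘ suc)) refl
term≤∑ {suc n} {f} 0≤f (suc i) = ≤-by-difference (f zero +ℚ r) (+-nonneg (0≤f zero) 0≤r)
  (trans (solve 3 (λ a b c → a :+ (b :+ c) := b :+ (a :+ c)) refl (f (suc i)) (f zero) r)
         (cong (f zero +ℚ_) (solve 2 (λ a s → a :+ (s :- a) := s) refl (f (suc i)) (∑ (f ∘ suc)))))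
  where
  open +-*-Solver
  r : ℚ
  r = ∑ (f ∘ suc) -ℚ f (suc i)
  0≤r : 0ℚ ≤ℚ r
  0≤r = subst (_≤ℚ r) (ℚ.+-inverseʳ (f (suc i))) (ℚ.+-monoˡ-≤ (-ℚ f (suc i)) (term≤∑ (0≤f ∘ suc) i))

∑-const : ∀ n c → ∑[ i < n ] c ≡ fromℕ n *ℚ c
∑-const zero    c = sym (ℚ.*-zeroˡ c)
∑-const (suc n) c = begin
  c +ℚ ∑[ i < n ] c        ≡⟨ cong (c +ℚ_) (∑-const n c) ⟩
  c +ℚ fromℕ n *ℚ c        ≡⟨ solve 2 (λ c m → c :+ m :* c := (con 1ℚ :+ m) :* c) refl c (fromℕ n) ⟩
  (1ℚ +ℚ fromℕ n) *ℚ c     ≡⟨ cong (_*ℚ c) (fromℕ-suc n) ⟨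
  fromℕ (suc n) *ℚ c       ∎
  where
  open ≡-Reasoning
  open +-*-Solver

∑-distrib-- : ∀ {n} (f g : Fin n → ℚ) → ∑[ i < n ] (f i -ℚ g i) ≡ ∑ f -ℚ ∑ g
∑-distrib-- {zero}  f g = refl
∑-distrib-- {suc n} f g = trans (cong (f zero -ℚ g zero +ℚ_) (∑-distrib-- (f ∘ suc) (g ∘ suc)))
  (solve 4 (λ a b c d → a :- b :+ (c :- d) := a :+ c :- (b :+ d)) refl
    (f zero) (g zero) (∑ (f ∘ suc)) (∑ (g ∘ suc)))
  where open +-*-Solver

∑-++ : ∀ m {n} (f : Fin (m ℕ.+ n) → ℚ) → ∑ f ≡ ∑[ i < m ] f (i ↑ˡ n) +ℚ ∑[ j < n ] f (m ↑ʳ j)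
∑-++ zero    f = sym (ℚ.+-identityˡ (∑ f))
∑-++ (suc m) f = trans (cong (f zero +ℚ_) (∑-++ m (f ∘ suc))) (sym (ℚ.+-assoc (f zero) _ _))

∑-combine : ∀ m {n} (f : Fin (m ℕ.* n) → ℚ) → ∑ f ≡ ∑[ i < m ] ∑[ j < n ] f (combine i j)
∑-combine zero        f = refl
∑-combine (suc m) {n} f = trans (∑-++ n f) (cong (∑[ j < n ] f (j ↑ˡ m ℕ.* n) +ℚ_) (∑-combine m (f ∘ (n ↑ʳ_))))

∑-only : ∀ {n} (f : Fin n → ℚ) i → (∀ j → j ≢ i → f j ≡ 0ℚ) → ∑ f ≡ f i
∑-only {suc n} f zero    f≡0 = trans
  (cong (f zero +ℚ_) (trans (sum-cong-≗ (λ j → f≡0 (suc j) λ ())) (sum-replicate-zero n)))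
  (ℚ.+-identityʳ (f zero))
∑-only {suc n} f (suc i) f≡0 = trans
  (cong₂ _+ℚ_ (f≡0 zero λ ()) (∑-only (f ∘ suc) i λ j j≢i → f≡0 (suc j) (j≢i ∘ Fin.suc-injective)))
  (ℚ.+-identityˡ (f (suc i)))

-- Pairs are numbered by `combine`, so that `r` becomes a self-inverse permutation of a single
-- `Fin (m * n)` and the sum can be reindexed by `sum-permute`. The intended `r` is a rotation map.
∑-involution : ∀ {m n} (r : Fin m × Fin n → Fin m × Fin n) → (∀ p → r (r p) ≡ p) →
  (f : Fin m × Fin n → ℚ) → ∑[ i < m ] ∑[ j < n ] f (r (i , j)) ≡ ∑[ i < m ] ∑[ j < n ] f (i , j)
∑-involution {m} {n} r r∘r f = begin
  ∑[ i < m ] ∑[ j < n ] f (r (i , j))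
    ≡⟨ sum-cong-≗ (λ i → sum-cong-≗ λ j → cong f (trans
         (remQuot-combine′ (r (remQuot n (combine i j)))) (cong r (Fin.remQuot-combine i j)))) ⟨
  ∑[ i < m ] ∑[ j < n ] g (π (combine i j))
    ≡⟨ ∑-combine m (g ∘ π) ⟨
  ∑ (g ∘ π)
    ≡⟨ sum-permute g (permutation π π π∘π π∘π) ⟨
  ∑ g
    ≡⟨ ∑-combine m g ⟩
  ∑[ i < m ] ∑[ j < n ] g (combine i j)
    ≡⟨ sum-cong-≗ (λ i → sum-cong-≗ λ j → cong f (Fin.remQuot-combine i j)) ⟩
  ∑[ i < m ] ∑[ j < n ] f (i , j) ∎
  where
  open ≡-Reasoning
  remQuot-combine′ : ∀ (p : Fin m × Fin n) → remQuot n (combine (proj₁ p) (proj₂ p)) ≡ p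
  remQuot-combine′ (i , j) = Fin.remQuot-combine i j
  g : Fin (m ℕ.* n) → ℚ
  g = f ∘ remQuot n
  π : Fin (m ℕ.* n) → Fin (m ℕ.* n)
  π w = let i , j = r (remQuot n w) in combine i j
  π∘π : ∀ w → π (π w) ≡ w
  π∘π w = let i , j = r (remQuot n w) in
    trans (cong (λ (i , j) → combine i j) (trans (cong r (Fin.remQuot-combine i j)) (r∘r (remQuot {m} n w))))
          (Fin.combine-remQuot {m} n w)

-- The two-step walk on an odd cycle

module OddCycle (D : ℕ) .{{_ : NonZero D}} (2∤D : ¬ (2 ∣ D)) where

  residue : ℕ → Fin D
  residue n = n mod D

  next prev : Fin D → Fin D
  next i = residue (toℕ i ℕ.+ 1)
  prev i = residue (toℕ i ℕ.+ (D ℕ.∸ 1))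

  -- The Dirichlet form of the two-step walk: `next i` and `prev i` are the two neighbours of `i`,
  -- hence two steps apart.
  roughness : (Fin D → ℚ) → ℚ
  roughness a = ∑[ i < D ] sq (a (next i) -ℚ a (prev i))

  -- The constant is fixed before `a`, so it is uniform in the function on the cycle. Packing it
  -- into a record lets bounds be composed along a walk without computing explicit values.
  record Controlled (L : (Fin D → ℚ) → ℚ) : Set where
    constructor bounded
    field
      constant        : ℚ
      constant-nonneg : 0ℚ ≤ℚ constant
      controls        : ∀ a → sq (L a) ≤ℚ constant *ℚ roughness a

  open Controlled

  roughness-nonneg : ∀ a → 0ℚ ≤ℚ roughness a
  roughness-nonneg a = ∑-nonneg λ i → sq-nonneg (a (next i) -ℚ a (prev i))

  controlled-resp : ∀ {L M} → (∀ a → L a ≡ M a) → Controlled L → Controlled M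
  controlled-resp L≗M (bounded c 0≤c h) = bounded c 0≤c λ a → subst (λ x → sq x ≤ℚ c *ℚ roughness a) (L≗M a) (h a)

  controlled-0 : Controlled λ _ → 0ℚ
  controlled-0 = bounded 0ℚ ℚ.≤-refl λ a → ℚ.≤-reflexive (sym (ℚ.*-zeroˡ (roughness a)))

  controlled-neg : ∀ {L} → Controlled L → Controlled λ a → -ℚ L a
  controlled-neg {L} (bounded c 0≤c h) = bounded c 0≤c λ a → subst (_≤ℚ c *ℚ roughness a)
    (solve 1 (λ x → x :* x := (:- x) :* (:- x)) refl (L a)) (h a)
    where open +-*-Solver

  controlled-+ : ∀ {L M} → Controlled L → Controlled M → Controlled λ a → L a +ℚ M a
  controlled-+ {L} {M} (bounded c 0≤c h) (bounded d 0≤d k) =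
    bounded (fromℕ 2 *ℚ (c +ℚ d)) (*-nonneg (fromℕ-nonneg 2) (+-nonneg 0≤c 0≤d)) λ a → begin
      sq (L a +ℚ M a)                                            ≤⟨ sq-+ (L a) (M a) ⟩
      fromℕ 2 *ℚ (sq (L a) +ℚ sq (M a))                          ≤⟨ *-monoˡ-≤ (fromℕ-nonneg 2) (ℚ.+-mono-≤ (h a) (k a)) ⟩
      fromℕ 2 *ℚ (c *ℚ roughness a +ℚ d *ℚ roughness a)
        ≡⟨ solve 3 (λ c d r → con (fromℕ 2) :* (c :* r :+ d :* r) := con (fromℕ 2) :* (c :+ d) :* r) refl c d (roughness a) ⟩
      fromℕ 2 *ℚ (c +ℚ d) *ℚ roughness a                         ∎
    where
    open ℚ.≤-Reasoning
    open +-*-Solver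

  controlled-∑ : ∀ {n} {L : Fin n → (Fin D → ℚ) → ℚ} → (∀ i → Controlled (L i)) → Controlled λ a → ∑[ i < n ] L i a
  controlled-∑ {zero}  h = controlled-0
  controlled-∑ {suc n} h = controlled-+ (h zero) (controlled-∑ (h ∘ suc))

  toℕ-residue : ∀ n → toℕ (residue n) ≡ n % D
  toℕ-residue n = Fin.toℕ-fromℕ< (m%n<n n D)

  residue-cong : ∀ {m n} → m % D ≡ n % D → residue m ≡ residue n
  residue-cong {m} {n} eq = Fin.toℕ-injective (trans (toℕ-residue m) (trans eq (sym (toℕ-residue n))))

  residue-toℕ : ∀ k → residue (toℕ k) ≡ k
  residue-toℕ k = Fin.toℕ-injective (trans (toℕ-residue (toℕ k)) (m<n⇒m%n≡m (Fin.toℕ<n k)))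

  residue-+ : ∀ m n → residue (toℕ (residue m) ℕ.+ n) ≡ residue (m ℕ.+ n)
  residue-+ m n = residue-cong (begin
    (toℕ (residue m) ℕ.+ n) % D         ≡⟨ cong (λ r → (r ℕ.+ n) % D) (toℕ-residue m) ⟩
    (m % D ℕ.+ n) % D                   ≡⟨ %-distribˡ-+ (m % D) n D ⟩
    (m % D % D ℕ.+ n % D) % D           ≡⟨ cong (λ r → (r ℕ.+ n % D) % D) (m%n%n≡m%n m D) ⟩
    (m % D ℕ.+ n % D) % D               ≡⟨ %-distribˡ-+ m n D ⟨
    (m ℕ.+ n) % D                       ∎)
    where open ≡-Reasoning

  residue-period : ∀ n → residue (n ℕ.+ D) ≡ residue n
  residue-period n = residue-cong ([m+n]%n≡m%n n D)

  next-residue : ∀ n → next (residue n) ≡ residue (suc n)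
  next-residue n = trans (residue-+ n 1) (cong residue (ℕ.+-comm n 1))

  -- Adding `D - 1` is subtracting 1 modulo `D`, because `suc n + (D - 1)` equals `n + D`.
  prev-residue : ∀ n → prev (residue (suc n)) ≡ residue n
  prev-residue n = trans (residue-+ (suc n) (D ℕ.∸ 1))
    (trans (cong residue (trans (sym (ℕ.+-suc n (D ℕ.∸ 1))) (cong (n ℕ.+_) (ℕ.suc-pred D)))) (residue-period n))

  -- Positions are natural numbers read modulo `D`, so that a walk may wind around the cycle and
  -- still be handled by induction on its length.
  step : ℕ → ℕ → (Fin D → ℚ) → ℚ
  step m n a = a (residue m) -ℚ a (residue n)

  step-trans : ∀ {l m n} → Controlled (step l m) → Controlled (step m n) → Controlled (step l n)
  step-trans {l} {m} {n} h k = controlled-resp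
    (λ a → solve 3 (λ x y z → x :- y :+ (y :- z) := x :- z) refl (a (residue l)) (a (residue m)) (a (residue n)))
    (controlled-+ h k)
    where open +-*-Solver

  step-sym : ∀ {m n} → Controlled (step m n) → Controlled (step n m)
  step-sym {m} {n} h = controlled-resp
    (λ a → solve 2 (λ x y → :- (x :- y) := y :- x) refl (a (residue m)) (a (residue n))) (controlled-neg h)
    where open +-*-Solver

  -- The difference squared is the summand of `roughness` at the middle vertex, the residue of
  -- `suc n`.
  two-steps : ∀ n → Controlled (step (2 ℕ.+ n) n)
  two-steps n = bounded 1ℚ (ℚ.nonNegative⁻¹ 1ℚ) λ a → begin
    sq (step (2 ℕ.+ n) n a)                      ≡⟨ cong₂ (λ i j → sq (a i -ℚ a j)) (next-residue (suc n)) (prev-residue n) ⟨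
    sq (a (next i) -ℚ a (prev i))                ≤⟨ term≤∑ (λ j → sq-nonneg (a (next j) -ℚ a (prev j))) i ⟩
    roughness a                                  ≡⟨ ℚ.*-identityˡ (roughness a) ⟨
    1ℚ *ℚ roughness a                            ∎
    where
    open ℚ.≤-Reasoning
    i : Fin D
    i = residue (suc n)

  even-steps : ∀ h n → Controlled (step (h ℕ.* 2 ℕ.+ n) n)
  even-steps zero    n = controlled-resp (λ a → sym (ℚ.+-inverseʳ (a (residue n)))) controlled-0
  even-steps (suc h) n = step-trans (two-steps (h ℕ.* 2 ℕ.+ n)) (even-steps h n)

  D%2≡1 : D % 2 ≡ 1
  D%2≡1 with D % 2 in eq | m%n<n D 2
  ... | 0           | _ = contradiction (ℕ.m%n≡0⇒n∣m D 2 eq) 2∤D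
  ... | 1           | _ = refl
  ... | suc (suc _) | ℕ.s≤s (ℕ.s≤s ())

  -- One step is D − 1 steps the other way round, and D − 1 is even.
  one-step : ∀ n → Controlled (step (suc n) n)
  one-step n = step-sym {n} {suc n} (controlled-resp
    (λ a → cong (λ i → a i -ℚ a (residue (suc n))) (trans (cong residue around) (residue-period n)))
    (even-steps (D / 2) (suc n)))
    where
    open ≡-Reasoning
    around : D / 2 ℕ.* 2 ℕ.+ suc n ≡ n ℕ.+ D
    around = begin
      D / 2 ℕ.* 2 ℕ.+ suc n             ≡⟨ ℕ.+-comm (D / 2 ℕ.* 2) (suc n) ⟩
      suc n ℕ.+ D / 2 ℕ.* 2             ≡⟨ ℕ.+-suc n (D / 2 ℕ.* 2) ⟨
      n ℕ.+ (1 ℕ.+ D / 2 ℕ.* 2)         ≡⟨ cong (λ r → n ℕ.+ (r ℕ.+ D / 2 ℕ.* 2)) D%2≡1 ⟨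
      n ℕ.+ (D % 2 ℕ.+ D / 2 ℕ.* 2)     ≡⟨ cong (n ℕ.+_) (m≡m%n+[m/n]*n D 2) ⟨
      n ℕ.+ D                           ∎

  steps-from-0 : ∀ n → Controlled (step n 0)
  steps-from-0 zero    = even-steps 0 0
  steps-from-0 (suc n) = step-trans (one-step n) (steps-from-0 n)

  difference-controlled : ∀ j k → Controlled λ a → a j -ℚ a k
  difference-controlled j k = controlled-resp
    (λ a → cong₂ (λ i l → a i -ℚ a l) (residue-toℕ j) (residue-toℕ k))
    (step-trans (steps-from-0 (toℕ j)) (step-sym {toℕ k} {0} (steps-from-0 (toℕ k))))

  -- `D` times the deviation of `a j` from the mean is the sum over `k` of `a j - a k`; scaling by
  -- `D` avoids a division.
  deviation-controlled : ∀ j → Controlled λ a → fromℕ D *ℚ a j -ℚ ∑ a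
  deviation-controlled j = controlled-resp
    (λ a → trans (∑-distrib-- (λ _ → a j) a) (cong (_-ℚ ∑ a) (∑-const D (a j))))
    (controlled-∑ (difference-controlled j))

  -- The constants for the individual `j` are nonnegative, so their sum serves for all `j` at once.
  deviation-bound : ∃ λ c → 0ℚ ≤ℚ c × ∀ a j → sq (fromℕ D *ℚ a j -ℚ ∑ a) ≤ℚ c *ℚ roughness a
  deviation-bound = ∑ c , ∑-nonneg (constant-nonneg ∘ deviation-controlled) , λ a j →
    ℚ.≤-trans (controls (deviation-controlled j) a)
      (*-monoʳ-≤ (roughness-nonneg a) (term≤∑ (constant-nonneg ∘ deviation-controlled) j))
    where
    c : Fin D → ℚ
    c = constant ∘ deviation-controlled

-- Averaging over neighbours

-- The normalized adjacency matrix acting on rational functions. Applied to the `n`-th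
-- approximations of a real vector, it gives the `n`-th approximations of the image.
average : ∀ {N D} .{{_ : NonZero D}} → Graph N D → (Fin N → ℚ) → Fin N → ℚ
average {N} {D} G f u = ∑[ v < N ] ((ℤ.+ edgeCount G u v ℚ./ D) *ℚ f v)

-- Each edge is seen from both of its ends, so an edge between distinct vertices contributes twice.
dirichlet : ∀ {N D} → Graph N D → (Fin N → ℚ) → ℚ
dirichlet {N} {D} G f = ∑[ v < N ] ∑[ i < D ] sq (f v -ℚ f (neighbour G v i))

-- Stated for squared norms, which stay rational; `r` plays the role of the square of the second
-- eigenvalue.
Contracts : ∀ {N D} .{{_ : NonZero D}} → Graph N D → ℚ → Set
Contracts {N} G r = ∀ f → ∑ f ≡ 0ℚ → ∑[ v < N ] sq (average G f v) ≤ℚ r *ℚ ∑[ v < N ] sq (f v)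

inverse : ∀ {p} → 0ℚ <ℚ p → ∃ λ q → 0ℚ <ℚ q × p *ℚ q ≡ 1ℚ
inverse = divide (ℚ.positive⁻¹ 1ℚ)

fromℕ-*-/ : ∀ n D .{{_ : NonZero D}} → fromℕ D *ℚ (ℤ.+ n ℚ./ D) ≡ fromℕ n
fromℕ-*-/ n (suc d) = ℚ.toℚᵘ-injective (begin
  ℚ.toℚᵘ (fromℕ (suc d) *ℚ (ℤ.+ n ℚ./ suc d))
    ≈⟨ ℚ.toℚᵘ-homo-* (fromℕ (suc d)) (ℤ.+ n ℚ./ suc d) ⟩
  ℚ.toℚᵘ (fromℕ (suc d)) ℚᵘ.* ℚ.toℚᵘ (ℤ.+ n ℚ./ suc d)
    ≈⟨ ℚᵘ.*-congˡ {ℚ.toℚᵘ (fromℕ (suc d))} (ℚ.toℚᵘ-fromℚᵘ (ℚᵘ.mkℚᵘ (ℤ.+ n) d)) ⟩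
  ℚ.toℚᵘ (fromℕ (suc d)) ℚᵘ.* ℚᵘ.mkℚᵘ (ℤ.+ n) d
    ≈⟨ ℚᵘ.*≡* (trans (ℤ.*-identityʳ (ℤ.+ suc d ℤ.* ℤ.+ n))
         (trans (ℤ.*-comm (ℤ.+ suc d) (ℤ.+ n)) (cong (λ m → ℤ.+ n ℤ.* ℤ.+ m) (sym (ℕ.*-identityˡ (suc d)))))) ⟩
  ℚ.toℚᵘ (fromℕ n) ∎)
  where open ℚᵘ.≃-Reasoning

fromℕ-sumℕ : ∀ {n} (f : Fin n → ℕ) → fromℕ (sumℕ f) ≡ ∑ (fromℕ ∘ f)
fromℕ-sumℕ {zero}  f = refl
fromℕ-sumℕ {suc n} f = trans (fromℕ-+ (f zero) (sumℕ (f ∘ suc))) (cong (fromℕ (f zero) +ℚ_) (fromℕ-sumℕ (f ∘ suc)))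

-- The left side is the sum of squared deviations from the mean `m`. Moving the centre from `m` to
-- `c` adds `n (c - m)²`, which is the slack.
variance-≤ : ∀ {n} (x : Fin n → ℚ) c m → fromℕ n *ℚ m ≡ ∑ x →
  ∑[ i < n ] sq (x i) -ℚ fromℕ n *ℚ sq m ≤ℚ ∑[ i < n ] sq (c -ℚ x i)
variance-≤ {n} x c m nm≡∑x = ≤-by-difference (fromℕ n *ℚ sq (c -ℚ m))
  (*-nonneg (fromℕ-nonneg n) (sq-nonneg (c -ℚ m))) (begin
  S -ℚ fromℕ n *ℚ sq m +ℚ fromℕ n *ℚ sq (c -ℚ m)
    ≡⟨ solve 4 (λ S n c m → S :- n :* (m :* m) :+ n :* ((c :- m) :* (c :- m))
         := n :* (c :* c) :- con (fromℕ 2) :* c :* (n :* m) :+ S) refl S (fromℕ n) c m ⟩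
  fromℕ n *ℚ sq c -ℚ fromℕ 2 *ℚ c *ℚ (fromℕ n *ℚ m) +ℚ S
    ≡⟨ cong (λ z → fromℕ n *ℚ sq c -ℚ fromℕ 2 *ℚ c *ℚ z +ℚ S) nm≡∑x ⟩
  fromℕ n *ℚ sq c -ℚ fromℕ 2 *ℚ c *ℚ ∑ x +ℚ S
    ≡⟨ cong₂ (λ y z → y -ℚ z +ℚ S) (∑-const n (sq c)) (sym (*-distribˡ-sum (fromℕ 2 *ℚ c) x)) ⟨
  ∑[ i < n ] sq c -ℚ ∑[ i < n ] (fromℕ 2 *ℚ c *ℚ x i) +ℚ S
    ≡⟨ cong (_+ℚ S) (∑-distrib-- (λ _ → sq c) (λ i → fromℕ 2 *ℚ c *ℚ x i)) ⟨
  ∑[ i < n ] (sq c -ℚ fromℕ 2 *ℚ c *ℚ x i) +ℚ S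
    ≡⟨ ∑-distrib-+ (λ i → sq c -ℚ fromℕ 2 *ℚ c *ℚ x i) (λ i → sq (x i)) ⟨
  ∑[ i < n ] (sq c -ℚ fromℕ 2 *ℚ c *ℚ x i +ℚ sq (x i))
    ≡⟨ sum-cong-≗ (λ i → solve 2 (λ c x → c :* c :- con (fromℕ 2) :* c :* x :+ x :* x
         := (c :- x) :* (c :- x)) refl c (x i)) ⟩
  ∑[ i < n ] sq (c -ℚ x i) ∎)
  where
  open ≡-Reasoning
  open +-*-Solver
  S : ℚ
  S = ∑[ i < n ] sq (x i)

module _ {N D} .{{_ : NonZero D}} (G : Graph N D) where

  -- For each label `i` at `u`, exactly one pair `(v , j)` equals `rot G (u , i)`, so the indicators
  -- counted by `edgeCount` collapse to one term per label.
  degree*average : ∀ f u → fromℕ D *ℚ average G f u ≡ ∑[ i < D ] f (neighbour G u i)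
  degree*average f u = begin
    fromℕ D *ℚ average G f u
      ≡⟨ *-distribˡ-sum (fromℕ D) (λ v → (ℤ.+ edgeCount G u v ℚ./ D) *ℚ f v) ⟩
    ∑[ v < N ] (fromℕ D *ℚ ((ℤ.+ edgeCount G u v ℚ./ D) *ℚ f v))
      ≡⟨ sum-cong-≗ (λ v → trans (sym (ℚ.*-assoc (fromℕ D) (ℤ.+ edgeCount G u v ℚ./ D) (f v)))
           (cong (_*ℚ f v) (trans (fromℕ-*-/ (edgeCount G u v) D) (count v)))) ⟩
    ∑[ v < N ] ((∑[ i < D ] edges i v) *ℚ f v)
      ≡⟨ sum-cong-≗ (λ v → *-distribʳ-sum (f v) (λ i → edges i v)) ⟩
    ∑[ v < N ] ∑[ i < D ] (edges i v *ℚ f v)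
      ≡⟨ ∑-comm (λ v i → edges i v *ℚ f v) ⟩
    ∑[ i < D ] ∑[ v < N ] (edges i v *ℚ f v)
      ≡⟨ sum-cong-≗ (λ i → trans
           (∑-only (λ v → edges i v *ℚ f v) (neighbour G u i)
             (λ v v≢ → trans (cong (_*ℚ f v) (edges≡0 i v v≢)) (ℚ.*-zeroˡ (f v))))
           (trans (cong (_*ℚ f (neighbour G u i)) (edges≡1 i)) (ℚ.*-identityˡ (f (neighbour G u i))))) ⟩
    ∑[ i < D ] f (neighbour G u i) ∎
    where
    open ≡-Reasoning
    _≟_ : ∀ (p q : Fin N × Fin D) → Dec (p ≡ q)
    _≟_ = ≡-dec Fin._≟_ Fin._≟_
    indicator : Fin D → Fin N → Fin D → ℕ
    indicator i v j = if does (rot G (u , i) ≟ (v , j)) then 1 else 0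
    edges : Fin D → Fin N → ℚ
    edges i v = ∑[ j < D ] fromℕ (indicator i v j)
    count : ∀ v → fromℕ (edgeCount G u v) ≡ ∑[ i < D ] edges i v
    count v = trans (fromℕ-sumℕ (λ i → sumℕ (indicator i v))) (sum-cong-≗ (λ i → fromℕ-sumℕ (indicator i v)))
    indicator≡0 : ∀ i v j → rot G (u , i) ≢ (v , j) → fromℕ (indicator i v j) ≡ 0ℚ
    indicator≡0 i v j ≢ = cong (λ b → fromℕ (if b then 1 else 0)) (dec-false (rot G (u , i) ≟ (v , j)) ≢)
    edges≡0 : ∀ i v → v ≢ neighbour G u i → edges i v ≡ 0ℚ
    edges≡0 i v v≢ = trans (sum-cong-≗ (λ j → indicator≡0 i v j (λ eq → v≢ (sym (cong proj₁ eq))))) (sum-replicate-zero D)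
    edges≡1 : ∀ i → edges i (neighbour G u i) ≡ 1ℚ
    edges≡1 i = trans
      (∑-only (λ j → fromℕ (indicator i (neighbour G u i) j)) (proj₂ (rot G (u , i)))
        (λ j j≢ → indicator≡0 i (neighbour G u i) j (λ eq → j≢ (sym (cong proj₂ eq)))))
      (cong (λ b → fromℕ (if b then 1 else 0)) (dec-true (rot G (u , i) ≟ rot G (u , i)) refl))

  -- Reindexing by the involution `rot G` exchanges the far end of every labelled edge with its near
  -- end.
  ∑-neighbour : ∀ f → ∑[ v < N ] ∑[ i < D ] f (neighbour G v i) ≡ fromℕ D *ℚ ∑ f
  ∑-neighbour f = begin
    ∑[ v < N ] ∑[ i < D ] f (neighbour G v i)   ≡⟨ ∑-involution (rot G) (involutive G) (f ∘ proj₁) ⟩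
    ∑[ v < N ] ∑[ i < D ] f v                   ≡⟨ sum-cong-≗ (λ v → ∑-const D (f v)) ⟩
    ∑[ v < N ] (fromℕ D *ℚ f v)                 ≡⟨ *-distribˡ-sum (fromℕ D) f ⟨
    fromℕ D *ℚ ∑ f                              ∎
    where open ≡-Reasoning

  -- At each vertex the neighbouring values deviate less, in the sum of squares, from their own
  -- average than from `f v`. This relates the norm of the averaged function to the Dirichlet form
  -- without any spectral decomposition.
  dirichlet-≥ : ∀ f →
    fromℕ D *ℚ (∑[ v < N ] sq (f v) -ℚ ∑[ v < N ] sq (average G f v)) ≤ℚ dirichlet G f
  dirichlet-≥ f = begin
    fromℕ D *ℚ (∑[ v < N ] sq (f v) -ℚ ∑[ v < N ] sq (average G f v))
      ≡⟨ solve 3 (λ d x y → d :* (x :- y) := d :* x :- d :* y) refl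
           (fromℕ D) (∑ (sq ∘ f)) (∑ (sq ∘ average G f)) ⟩
    fromℕ D *ℚ (∑[ v < N ] sq (f v)) -ℚ fromℕ D *ℚ (∑[ v < N ] sq (average G f v))
      ≡⟨ cong₂ _-ℚ_ (∑-neighbour (sq ∘ f)) (sym (*-distribˡ-sum (fromℕ D) (sq ∘ average G f))) ⟨
    ∑[ v < N ] ∑[ i < D ] sq (f (neighbour G v i)) -ℚ ∑[ v < N ] (fromℕ D *ℚ sq (average G f v))
      ≡⟨ ∑-distrib-- (λ v → ∑[ i < D ] sq (f (neighbour G v i))) (λ v → fromℕ D *ℚ sq (average G f v)) ⟨
    ∑[ v < N ] (∑[ i < D ] sq (f (neighbour G v i)) -ℚ fromℕ D *ℚ sq (average G f v))
      ≤⟨ ∑-mono (λ v → variance-≤ (f ∘ neighbour G v) (f v) (average G f v) (degree*average f v)) ⟩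
    dirichlet G f ∎
    where
    open ℚ.≤-Reasoning
    open +-*-Solver

module _ {N D} .{{_ : NonZero N}} .{{_ : NonZero D}} (G : Graph N D) where

  -- The mean is subtracted from f, since contraction is only known for functions of sum zero.
  poincaré : ∀ {r q} → 0ℚ ≤ℚ q → 0ℚ ≤ℚ 1ℚ -ℚ r → (1ℚ -ℚ r) *ℚ q ≡ 1ℚ → Contracts G r →
    ∀ f → ∑[ v < N ] sq (f v) ≤ℚ fromℕ 2 *ℚ (q *ℚ dirichlet G f +ℚ sq (∑ f))
  poincaré {r} {q} 0≤q 0≤1-r [1-r]q≡1 contracts f = begin
    ∑[ v < N ] sq (f v)
      ≤⟨ ∑-mono (λ v → subst (λ x → sq x ≤ℚ fromℕ 2 *ℚ (sq (g v) +ℚ sq t))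
           (solve 2 (λ x t → x :- t :+ t := x) refl (f v) t) (sq-+ (g v) t)) ⟩
    ∑[ v < N ] (fromℕ 2 *ℚ (sq (g v) +ℚ sq t))
      ≡⟨ *-distribˡ-sum (fromℕ 2) (λ v → sq (g v) +ℚ sq t) ⟨
    fromℕ 2 *ℚ ∑[ v < N ] (sq (g v) +ℚ sq t)
      ≡⟨ cong (fromℕ 2 *ℚ_) (trans (∑-distrib-+ (sq ∘ g) (λ _ → sq t)) (cong (S +ℚ_) (∑-const N (sq t)))) ⟩
    fromℕ 2 *ℚ (S +ℚ fromℕ N *ℚ sq t)
      ≤⟨ *-monoˡ-≤ (fromℕ-nonneg 2) (ℚ.+-mono-≤ S≤ t≤) ⟩
    fromℕ 2 *ℚ (q *ℚ dirichlet G f +ℚ sq (∑ f)) ∎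
    where
    open ℚ.≤-Reasoning
    open +-*-Solver
    N⁻¹ t : ℚ
    N⁻¹ = proj₁ (inverse (ℚ.<-≤-trans (ℚ.positive⁻¹ 1ℚ) (1≤fromℕ N)))
    t = N⁻¹ *ℚ ∑ f
    Nt≡∑f : fromℕ N *ℚ t ≡ ∑ f
    Nt≡∑f = trans (sym (ℚ.*-assoc (fromℕ N) N⁻¹ (∑ f)))
      (trans (cong (_*ℚ ∑ f) (proj₂ (proj₂ (inverse (ℚ.<-≤-trans (ℚ.positive⁻¹ 1ℚ) (1≤fromℕ N))))))
             (ℚ.*-identityˡ (∑ f)))
    g : Fin N → ℚ
    g v = f v -ℚ t
    S : ℚ
    S = ∑[ v < N ] sq (g v)
    ∑g≡0 : ∑ g ≡ 0ℚ
    ∑g≡0 = trans (∑-distrib-- f (λ _ → t))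
      (trans (cong (λ z → ∑ f -ℚ z) (trans (∑-const N t) Nt≡∑f)) (ℚ.+-inverseʳ (∑ f)))
    dirichlet-g : dirichlet G g ≡ dirichlet G f
    dirichlet-g = sum-cong-≗ λ v → sum-cong-≗ λ i → cong sq
      (solve 3 (λ x y t → x :- t :- (y :- t) := x :- y) refl (f v) (f (neighbour G v i)) t)
    [1-r]S≤ : (1ℚ -ℚ r) *ℚ S ≤ℚ dirichlet G f
    [1-r]S≤ = begin
      (1ℚ -ℚ r) *ℚ S
        ≡⟨ ℚ.*-identityˡ ((1ℚ -ℚ r) *ℚ S) ⟨
      1ℚ *ℚ ((1ℚ -ℚ r) *ℚ S)
        ≤⟨ *-monoʳ-≤ (*-nonneg 0≤1-r (∑-nonneg (sq-nonneg ∘ g))) (1≤fromℕ D) ⟩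
      fromℕ D *ℚ ((1ℚ -ℚ r) *ℚ S)
        ≡⟨ cong (fromℕ D *ℚ_) (solve 2 (λ r s → (con 1ℚ :- r) :* s := s :- r :* s) refl r S) ⟩
      fromℕ D *ℚ (S -ℚ r *ℚ S)
        ≤⟨ *-monoˡ-≤ (fromℕ-nonneg D) (ℚ.+-monoʳ-≤ S (ℚ.neg-antimono-≤ (contracts g ∑g≡0))) ⟩
      fromℕ D *ℚ (S -ℚ ∑[ v < N ] sq (average G g v))
        ≤⟨ dirichlet-≥ G g ⟩
      dirichlet G g
        ≡⟨ dirichlet-g ⟩
      dirichlet G f ∎
    S≤ : S ≤ℚ q *ℚ dirichlet G f
    S≤ = begin
      S                           ≡⟨ ℚ.*-identityˡ S ⟨
      1ℚ *ℚ S                     ≡⟨ cong (_*ℚ S) [1-r]q≡1 ⟨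
      (1ℚ -ℚ r) *ℚ q *ℚ S         ≡⟨ solve 3 (λ x q s → x :* q :* s := q :* (x :* s)) refl (1ℚ -ℚ r) q S ⟩
      q *ℚ ((1ℚ -ℚ r) *ℚ S)       ≤⟨ *-monoˡ-≤ 0≤q [1-r]S≤ ⟩
      q *ℚ dirichlet G f          ∎
    -- As `N t` is the sum of `f`, the left side is `sq (∑ f)` divided by `N`; this division is
    -- given up so that the bound does not depend on `N`.
    t≤ : fromℕ N *ℚ sq t ≤ℚ sq (∑ f)
    t≤ = begin
      fromℕ N *ℚ sq t                 ≡⟨ ℚ.*-identityˡ (fromℕ N *ℚ sq t) ⟨
      1ℚ *ℚ (fromℕ N *ℚ sq t)         ≤⟨ *-monoʳ-≤ (*-nonneg (fromℕ-nonneg N) (sq-nonneg t)) (1≤fromℕ N) ⟩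
      fromℕ N *ℚ (fromℕ N *ℚ sq t)    ≡⟨ solve 2 (λ n t → n :* (n :* (t :* t)) := n :* t :* (n :* t)) refl (fromℕ N) t ⟩
      sq (fromℕ N *ℚ t)               ≡⟨ cong sq Nt≡∑f ⟩
      sq (∑ f)                        ∎

-- Energy of a cubic graph and of the replacement product

module _ {N} (H : Graph N 3) where

  spread : (Fin N → ℚ) → Fin N → ℚ
  spread a w = sq (x 0F -ℚ x 1F) +ℚ sq (x 0F -ℚ x 2F) +ℚ sq (x 1F -ℚ x 2F)
    where
    x : Fin 3 → ℚ
    x i = a (neighbour H w i)

  energy : (Fin N → ℚ) → ℚ
  energy a = ∑ (spread a)

  spread-nonneg : ∀ a w → 0ℚ ≤ℚ spread a w
  spread-nonneg a w = +-nonneg (+-nonneg (sq-nonneg (x 0F -ℚ x 1F)) (sq-nonneg (x 0F -ℚ x 2F))) (sq-nonneg (x 1F -ℚ x 2F))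
    where
    x : Fin 3 → ℚ
    x i = a (neighbour H w i)

  spread-≥₀₁ : ∀ a w → sq (a (neighbour H w 0F) -ℚ a (neighbour H w 1F)) ≤ℚ spread a w
  spread-≥₀₁ a w = ≤-by-difference (sq (x 0F -ℚ x 2F) +ℚ sq (x 1F -ℚ x 2F))
    (+-nonneg (sq-nonneg (x 0F -ℚ x 2F)) (sq-nonneg (x 1F -ℚ x 2F)))
    (sym (ℚ.+-assoc (sq (x 0F -ℚ x 1F)) (sq (x 0F -ℚ x 2F)) (sq (x 1F -ℚ x 2F))))
    where
    x : Fin 3 → ℚ
    x i = a (neighbour H w i)

  spread-≥₀₂ : ∀ a w → sq (a (neighbour H w 0F) -ℚ a (neighbour H w 2F)) ≤ℚ spread a w
  spread-≥₀₂ a w = ≤-by-difference (sq (x 0F -ℚ x 1F) +ℚ sq (x 1F -ℚ x 2F))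
    (+-nonneg (sq-nonneg (x 0F -ℚ x 1F)) (sq-nonneg (x 1F -ℚ x 2F)))
    (solve 3 (λ p q r → q :+ (p :+ r) := p :+ q :+ r) refl
      (sq (x 0F -ℚ x 1F)) (sq (x 0F -ℚ x 2F)) (sq (x 1F -ℚ x 2F)))
    where
    open +-*-Solver
    x : Fin 3 → ℚ
    x i = a (neighbour H w i)

  average-energy : ∀ a →
    fromℕ 9 *ℚ ∑[ w < N ] sq (average H a w) +ℚ energy a ≡ fromℕ 9 *ℚ ∑[ w < N ] sq (a w)
  average-energy a = begin
    fromℕ 9 *ℚ ∑[ w < N ] sq (average H a w) +ℚ energy a
      ≡⟨ cong (_+ℚ energy a) (*-distribˡ-sum (fromℕ 9) (sq ∘ average H a)) ⟩
    ∑[ w < N ] (fromℕ 9 *ℚ sq (average H a w)) +ℚ energy a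
      ≡⟨ ∑-distrib-+ (λ w → fromℕ 9 *ℚ sq (average H a w)) (spread a) ⟨
    ∑[ w < N ] (fromℕ 9 *ℚ sq (average H a w) +ℚ spread a w)
      ≡⟨ sum-cong-≗ pointwise ⟩
    ∑[ w < N ] (fromℕ 3 *ℚ ∑[ i < 3 ] sq (a (neighbour H w i)))
      ≡⟨ *-distribˡ-sum (fromℕ 3) (λ w → ∑[ i < 3 ] sq (a (neighbour H w i))) ⟨
    fromℕ 3 *ℚ ∑[ w < N ] ∑[ i < 3 ] sq (a (neighbour H w i))
      ≡⟨ cong (fromℕ 3 *ℚ_) (∑-neighbour H (sq ∘ a)) ⟩
    fromℕ 3 *ℚ (fromℕ 3 *ℚ ∑[ w < N ] sq (a w))
      ≡⟨ ℚ.*-assoc (fromℕ 3) (fromℕ 3) (∑ (sq ∘ a)) ⟨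
    fromℕ 9 *ℚ ∑[ w < N ] sq (a w) ∎
    where
    open ≡-Reasoning
    open +-*-Solver
    pointwise : ∀ w → fromℕ 9 *ℚ sq (average H a w) +ℚ spread a w ≡ fromℕ 3 *ℚ ∑[ i < 3 ] sq (a (neighbour H w i))
    pointwise w = begin
      fromℕ 9 *ℚ sq (average H a w) +ℚ spread a w
        ≡⟨ cong (_+ℚ spread a w) (solve 1 (λ m → con (fromℕ 9) :* (m :* m)
             := con (fromℕ 3) :* m :* (con (fromℕ 3) :* m)) refl (average H a w)) ⟩
      sq (fromℕ 3 *ℚ average H a w) +ℚ spread a w
        ≡⟨ cong (λ z → sq z +ℚ spread a w) (degree*average H a w) ⟩
      sq (∑[ i < 3 ] x i) +ℚ spread a w
        ≡⟨ solve 3 (λ x y z → (x :+ (y :+ (z :+ con 0ℚ))) :* (x :+ (y :+ (z :+ con 0ℚ)))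
             :+ ((x :- y) :* (x :- y) :+ (x :- z) :* (x :- z) :+ (y :- z) :* (y :- z))
             := con (fromℕ 3) :* (x :* x :+ (y :* y :+ (z :* z :+ con 0ℚ)))) refl (x 0F) (x 1F) (x 2F) ⟩
      fromℕ 3 *ℚ ∑[ i < 3 ] sq (x i) ∎
      where
      x : Fin 3 → ℚ
      x i = a (neighbour H w i)

-- Comparing norm and energy on the replacement product

module Replacement {D : ℕ} .{{_ : NonZero D}} (2∤D : ¬ (2 ∣ D)) where

  open OddCycle D 2∤D using (next; prev; roughness; deviation-bound)

  c d : ℚ
  c = proj₁ deviation-bound
  d = fromℕ D

  0≤c : 0ℚ ≤ℚ c
  0≤c = proj₁ (proj₂ deviation-bound)

  0≤d : 0ℚ ≤ℚ d
  0≤d = fromℕ-nonneg D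

  module _ {N} (G : Graph N D) (C : Graph D 2) (cycle : IsCycle C) (a : Fin (N ℕ.* D) → ℚ) where

    H : Graph (N ℕ.* D) 3
    H = replacementProduct G C

    E : ℚ
    E = energy H a

    row : Fin N → Fin D → ℚ
    row v k = a (combine v k)

    total : Fin N → ℚ
    total v = ∑ (row v)

    R : Fin N → ℚ
    R v = roughness (row v)

    -- Once the vertex is decoded, `splitAt 2 i` computes on concrete labels: `0F` and `1F` are the
    -- cycle edges, and `2F` is the edge of `G`.
    neighbour-H : ∀ v k i → neighbour H (combine v k) i ≡
      proj₁ (encode G C (replacementRot G C ((v , k) , splitAt 2 i)))
    neighbour-H v k i = cong (λ p → proj₁ (encode G C (replacementRot G C (p , splitAt 2 i)))) (Fin.remQuot-combine v k)

    -- The two orders in which `C` may list the neighbours differ by a sign inside the square.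
    roughness-≤ : ∀ v k → sq (row v (next k) -ℚ row v (prev k)) ≤ℚ spread H a (combine v k)
    roughness-≤ v k = subst (_≤ℚ spread H a (combine v k)) (trans
      (cong₂ (λ x y → sq (a x -ℚ a y)) (neighbour-H v k 0F) (neighbour-H v k 1F)) (orient (cycle k)))
      (spread-≥₀₁ H a (combine v k))
      where
      open +-*-Solver
      orient : _ → sq (row v (neighbour C k 0F) -ℚ row v (neighbour C k 1F)) ≡ sq (row v (next k) -ℚ row v (prev k))
      orient (inj₁ (eq₀ , eq₁)) = cong₂ (λ i j → sq (row v i -ℚ row v j)) eq₀ eq₁
      orient (inj₂ (eq₀ , eq₁)) = trans (cong₂ (λ i j → sq (row v i -ℚ row v j)) eq₀ eq₁)
        (solve 2 (λ x y → (x :- y) :* (x :- y) := (y :- x) :* (y :- x)) refl (row v (prev k)) (row v (next k)))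

    -- One comparison between a cycle neighbour and the neighbour across `G` is enough to link the
    -- cloud of `v` to that of `v′`; label `0F` is chosen.
    crossing-≤ : ∀ v k → let v′ , k′ = rot G (v , k) in
      sq (row v (neighbour C k 0F) -ℚ row v′ k′) ≤ℚ spread H a (combine v k)
    crossing-≤ v k = subst (_≤ℚ spread H a (combine v k))
      (cong₂ (λ x y → sq (a x -ℚ a y)) (neighbour-H v k 0F) (neighbour-H v k 2F)) (spread-≥₀₂ H a (combine v k))

    ∑R≤E : ∑ R ≤ℚ E
    ∑R≤E = ℚ.≤-trans (∑-mono (λ v → ∑-mono (roughness-≤ v))) (ℚ.≤-reflexive (sym (∑-combine N (spread H a))))

    deviation : ∀ v k → sq (d *ℚ row v k -ℚ total v) ≤ℚ c *ℚ R v
    deviation v k = proj₂ (proj₂ deviation-bound) (row v) k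

    -- Along an edge of `G`, the difference of totals splits into a deviation in the first cloud,
    -- `d` times a crossing difference, and a deviation in the second cloud. `sq-+₃` costs the
    -- factor 3; each kind of deviation sums to `c d ∑ R`, and the crossings to `sq d` times the
    -- energy.
    dirichlet-total-≤ : dirichlet G total ≤ℚ fromℕ 3 *ℚ (fromℕ 2 *ℚ c *ℚ d +ℚ sq d) *ℚ E
    dirichlet-total-≤ = begin
      dirichlet G total
        ≤⟨ ∑-mono (λ v → ∑-mono (edge v)) ⟩
      ∑[ v < N ] ∑[ k < D ] (fromℕ 3 *ℚ terms v k)
        ≡⟨ sum-cong-≗ (λ v → trans (sym (*-distribˡ-sum (fromℕ 3) (terms v))) (cong (fromℕ 3 *ℚ_) (split v))) ⟩
      ∑[ v < N ] (fromℕ 3 *ℚ (d *ℚ (c *ℚ R v) +ℚ sq d *ℚ ∑ (s v) +ℚ c *ℚ R′ v))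
        ≡⟨ trans (sym (*-distribˡ-sum (fromℕ 3) (λ v → d *ℚ (c *ℚ R v) +ℚ sq d *ℚ ∑ (s v) +ℚ c *ℚ R′ v)))
             (cong (fromℕ 3 *ℚ_) split′) ⟩
      fromℕ 3 *ℚ (d *ℚ (c *ℚ ∑ R) +ℚ sq d *ℚ E +ℚ c *ℚ (d *ℚ ∑ R))
        ≡⟨ solve 4 (λ c d r e → con (fromℕ 3) :* (d :* (c :* r) :+ d :* d :* e :+ c :* (d :* r))
             := con (fromℕ 3) :* (con (fromℕ 2) :* c :* d :* r :+ d :* d :* e)) refl c d (∑ R) E ⟩
      fromℕ 3 *ℚ (fromℕ 2 *ℚ c *ℚ d *ℚ ∑ R +ℚ sq d *ℚ E)
        ≤⟨ *-monoˡ-≤ (fromℕ-nonneg 3) (ℚ.+-monoˡ-≤ (sq d *ℚ E)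
             (*-monoˡ-≤ (*-nonneg (*-nonneg (fromℕ-nonneg 2) 0≤c) 0≤d) ∑R≤E)) ⟩
      fromℕ 3 *ℚ (fromℕ 2 *ℚ c *ℚ d *ℚ E +ℚ sq d *ℚ E)
        ≡⟨ solve 3 (λ c d e → con (fromℕ 3) :* (con (fromℕ 2) :* c :* d :* e :+ d :* d :* e)
             := con (fromℕ 3) :* (con (fromℕ 2) :* c :* d :+ d :* d) :* e) refl c d E ⟩
      fromℕ 3 *ℚ (fromℕ 2 *ℚ c *ℚ d +ℚ sq d) *ℚ E ∎
      where
      open ℚ.≤-Reasoning
      open +-*-Solver
      s : Fin N → Fin D → ℚ
      s v k = spread H a (combine v k)
      terms : Fin N → Fin D → ℚ
      terms v k = c *ℚ R v +ℚ sq d *ℚ s v k +ℚ c *ℚ R (neighbour G v k)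
      R′ : Fin N → ℚ
      R′ v = ∑[ k < D ] R (neighbour G v k)
      edge : ∀ v k → sq (total v -ℚ total (neighbour G v k)) ≤ℚ fromℕ 3 *ℚ terms v k
      edge v k = begin
        sq (total v -ℚ total v′)
          ≡⟨ cong sq (solve 5 (λ d t t′ x x′ → t :- t′ := :- (d :* x :- t) :+ d :* (x :- x′) :+ (d :* x′ :- t′)) refl
               d (total v) (total v′) x x′) ⟩
        sq (-ℚ (d *ℚ x -ℚ total v) +ℚ d *ℚ (x -ℚ x′) +ℚ (d *ℚ x′ -ℚ total v′))
          ≤⟨ sq-+₃ (-ℚ (d *ℚ x -ℚ total v)) (d *ℚ (x -ℚ x′)) (d *ℚ x′ -ℚ total v′) ⟩
        fromℕ 3 *ℚ (sq (-ℚ (d *ℚ x -ℚ total v)) +ℚ sq (d *ℚ (x -ℚ x′)) +ℚ sq (d *ℚ x′ -ℚ total v′))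
          ≡⟨ cong₂ (λ y z → fromℕ 3 *ℚ (y +ℚ z +ℚ sq (d *ℚ x′ -ℚ total v′)))
               (solve 1 (λ y → (:- y) :* (:- y) := y :* y) refl (d *ℚ x -ℚ total v))
               (solve 2 (λ d y → d :* y :* (d :* y) := d :* d :* (y :* y)) refl d (x -ℚ x′)) ⟩
        fromℕ 3 *ℚ (sq (d *ℚ x -ℚ total v) +ℚ sq d *ℚ sq (x -ℚ x′) +ℚ sq (d *ℚ x′ -ℚ total v′))
          ≤⟨ *-monoˡ-≤ (fromℕ-nonneg 3) (ℚ.+-mono-≤
               (ℚ.+-mono-≤ (deviation v (neighbour C k 0F)) (*-monoˡ-≤ (sq-nonneg d) (crossing-≤ v k)))
               (deviation v′ k′)) ⟩
        fromℕ 3 *ℚ (c *ℚ R v +ℚ sq d *ℚ s v k +ℚ c *ℚ R v′) ∎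
        where
        v′ : Fin N
        v′ = neighbour G v k
        k′ : Fin D
        k′ = proj₂ (rot G (v , k))
        x x′ : ℚ
        x = row v (neighbour C k 0F)
        x′ = row v′ k′
      split : ∀ v → ∑ (terms v) ≡ d *ℚ (c *ℚ R v) +ℚ sq d *ℚ ∑ (s v) +ℚ c *ℚ R′ v
      split v = trans (∑-distrib-+ (λ k → c *ℚ R v +ℚ sq d *ℚ s v k) (λ k → c *ℚ R (neighbour G v k)))
        (cong₂ _+ℚ_
          (trans (∑-distrib-+ (λ _ → c *ℚ R v) (λ k → sq d *ℚ s v k))
            (cong₂ _+ℚ_ (∑-const D (c *ℚ R v)) (sym (*-distribˡ-sum (sq d) (s v)))))
          (sym (*-distribˡ-sum c (λ k → R (neighbour G v k)))))
      split′ : ∑[ v < N ] (d *ℚ (c *ℚ R v) +ℚ sq d *ℚ ∑ (s v) +ℚ c *ℚ R′ v)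
        ≡ d *ℚ (c *ℚ ∑ R) +ℚ sq d *ℚ E +ℚ c *ℚ (d *ℚ ∑ R)
      split′ = trans (∑-distrib-+ (λ v → d *ℚ (c *ℚ R v) +ℚ sq d *ℚ ∑ (s v)) (λ v → c *ℚ R′ v))
        (cong₂ _+ℚ_
          (trans (∑-distrib-+ (λ v → d *ℚ (c *ℚ R v)) (λ v → sq d *ℚ ∑ (s v)))
            (cong₂ _+ℚ_
              (trans (sym (*-distribˡ-sum d (λ v → c *ℚ R v))) (cong (d *ℚ_) (sym (*-distribˡ-sum c R))))
              (trans (sym (*-distribˡ-sum (sq d) (λ v → ∑ (s v)))) (cong (sq d *ℚ_) (sym (∑-combine N (spread H a)))))))
          (trans (sym (*-distribˡ-sum c R′)) (cong (c *ℚ_) (∑-neighbour G R))))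

    -- Since `D` is at least 1, an entry is bounded in square by its multiple by `d`, which is a
    -- deviation plus the cloud total. The factor 2 comes from `sq-+` and `d` from the number of
    -- entries in a cloud.
    norm-≤ : ∑[ w < N ℕ.* D ] sq (a w) ≤ℚ fromℕ 2 *ℚ d *ℚ (c *ℚ E +ℚ ∑[ v < N ] sq (total v))
    norm-≤ = begin
      ∑[ w < N ℕ.* D ] sq (a w)
        ≡⟨ ∑-combine N (sq ∘ a) ⟩
      ∑[ v < N ] ∑[ k < D ] sq (row v k)
        ≤⟨ ∑-mono (λ v → ∑-mono (entry v)) ⟩
      ∑[ v < N ] ∑[ k < D ] (fromℕ 2 *ℚ (c *ℚ R v +ℚ sq (total v)))
        ≡⟨ sum-cong-≗ (λ v → trans (∑-const D _) (solve 3 (λ d x y → d :* (con (fromℕ 2) :* (x :+ y))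
             := con (fromℕ 2) :* d :* (x :+ y)) refl d (c *ℚ R v) (sq (total v)))) ⟩
      ∑[ v < N ] (fromℕ 2 *ℚ d *ℚ (c *ℚ R v +ℚ sq (total v)))
        ≡⟨ *-distribˡ-sum (fromℕ 2 *ℚ d) (λ v → c *ℚ R v +ℚ sq (total v)) ⟨
      fromℕ 2 *ℚ d *ℚ ∑[ v < N ] (c *ℚ R v +ℚ sq (total v))
        ≡⟨ cong (fromℕ 2 *ℚ d *ℚ_) (trans (∑-distrib-+ (λ v → c *ℚ R v) (sq ∘ total))
             (cong (_+ℚ ∑ (sq ∘ total)) (sym (*-distribˡ-sum c R)))) ⟩
      fromℕ 2 *ℚ d *ℚ (c *ℚ ∑ R +ℚ ∑[ v < N ] sq (total v))
        ≤⟨ *-monoˡ-≤ (*-nonneg (fromℕ-nonneg 2) 0≤d) (ℚ.+-monoˡ-≤ (∑ (sq ∘ total)) (*-monoˡ-≤ 0≤c ∑R≤E)) ⟩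
      fromℕ 2 *ℚ d *ℚ (c *ℚ E +ℚ ∑[ v < N ] sq (total v)) ∎
      where
      open ℚ.≤-Reasoning
      open +-*-Solver
      entry : ∀ v k → sq (row v k) ≤ℚ fromℕ 2 *ℚ (c *ℚ R v +ℚ sq (total v))
      entry v k = begin
        sq x                                              ≤⟨ sq-scale ⟩
        sq (d *ℚ x)                                       ≡⟨ cong sq (solve 2 (λ y t → y := y :- t :+ t) refl (d *ℚ x) (total v)) ⟩
        sq (d *ℚ x -ℚ total v +ℚ total v)                 ≤⟨ sq-+ (d *ℚ x -ℚ total v) (total v) ⟩
        fromℕ 2 *ℚ (sq (d *ℚ x -ℚ total v) +ℚ sq (total v))
          ≤⟨ *-monoˡ-≤ (fromℕ-nonneg 2) (ℚ.+-monoˡ-≤ (sq (total v)) (deviation v k)) ⟩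
        fromℕ 2 *ℚ (c *ℚ R v +ℚ sq (total v))             ∎
        where
        x : ℚ
        x = row v k
        sq-scale : sq x ≤ℚ sq (d *ℚ x)
        sq-scale = begin
          sq x                  ≡⟨ ℚ.*-identityˡ (sq x) ⟨
          1ℚ *ℚ sq x            ≤⟨ *-monoʳ-≤ (sq-nonneg x) (*-mono-≤ (ℚ.nonNegative⁻¹ 1ℚ) 0≤d (1≤fromℕ D) (1≤fromℕ D)) ⟩
          sq d *ℚ sq x          ≡⟨ solve 2 (λ d x → d :* d :* (x :* x) := d :* x :* (d :* x)) refl d x ⟩
          sq (d *ℚ x)           ∎

  -- Writing `A` for the squared norm, `e` for the energy and `S` for `sq (∑ a)`, the estimates
  -- combine to `A ≤ κ (e + S)`. With `τ = 1 / (9 κ)` this reads `9 τ A ≤ e + S`, which is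
  -- substituted into `average-energy`. `τ` is chosen before the graphs, so it depends on `r` and
  -- `D` alone.
  replacement-contraction : ∀ {r} → r <ℚ 1ℚ → ∃ λ τ → 0ℚ <ℚ τ × τ ≤ℚ 1ℚ ×
    (∀ {N} .{{_ : NonZero N}} (G : Graph N D) (C : Graph D 2) → IsCycle C → Contracts G r →
      ∀ a → ∑[ w < N ℕ.* D ] sq (average (replacementProduct G C) a w) ≤ℚ
            (1ℚ -ℚ τ) *ℚ ∑[ w < N ℕ.* D ] sq (a w) +ℚ sq (∑ a))
  replacement-contraction {r} r<1 = τ , 0<τ , τ≤1 , contraction
    where
    open ℚ.≤-Reasoning
    open +-*-Solver
    0<1-r : 0ℚ <ℚ 1ℚ -ℚ r
    0<1-r = subst (_<ℚ 1ℚ -ℚ r) (ℚ.+-inverseʳ r) (ℚ.+-monoˡ-< (-ℚ r) r<1)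
    q k m κ τ : ℚ
    q = proj₁ (inverse 0<1-r)
    k = fromℕ 3 *ℚ (fromℕ 2 *ℚ c *ℚ d +ℚ sq d)
    m = fromℕ 2 *ℚ d *ℚ (c +ℚ fromℕ 2 *ℚ q *ℚ k)
    -- In the bound for `A`, the energy has coefficient `m` and the error term has coefficient
    -- `4 d`. Their sum dominates both, and the extra 1 keeps `κ` away from 0 and gives `τ ≤ 1`.
    κ = m +ℚ fromℕ 4 *ℚ d +ℚ 1ℚ
    0≤q : 0ℚ ≤ℚ q
    0≤q = ℚ.<⇒≤ (proj₁ (proj₂ (inverse 0<1-r)))
    0≤k : 0ℚ ≤ℚ k
    0≤k = *-nonneg (fromℕ-nonneg 3) (+-nonneg (*-nonneg (*-nonneg (fromℕ-nonneg 2) 0≤c) 0≤d) (sq-nonneg d))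
    0≤m : 0ℚ ≤ℚ m
    0≤m = *-nonneg (*-nonneg (fromℕ-nonneg 2) 0≤d) (+-nonneg 0≤c (*-nonneg (*-nonneg (fromℕ-nonneg 2) 0≤q) 0≤k))
    0≤κ-1 : 0ℚ ≤ℚ m +ℚ fromℕ 4 *ℚ d
    0≤κ-1 = +-nonneg 0≤m (*-nonneg (fromℕ-nonneg 4) 0≤d)
    1≤9κ : 1ℚ ≤ℚ fromℕ 9 *ℚ κ
    1≤9κ = ≤-by-difference (fromℕ 9 *ℚ (m +ℚ fromℕ 4 *ℚ d) +ℚ fromℕ 8)
      (+-nonneg (*-nonneg (fromℕ-nonneg 9) 0≤κ-1) (fromℕ-nonneg 8))
      (solve 1 (λ x → con 1ℚ :+ (con (fromℕ 9) :* x :+ con (fromℕ 8)) := con (fromℕ 9) :* (x :+ con 1ℚ))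
        refl (m +ℚ fromℕ 4 *ℚ d))
    inv : ∃ λ τ → 0ℚ <ℚ τ × fromℕ 9 *ℚ κ *ℚ τ ≡ 1ℚ
    inv = inverse (ℚ.<-≤-trans (ℚ.positive⁻¹ 1ℚ) 1≤9κ)
    τ = proj₁ inv
    0<τ : 0ℚ <ℚ τ
    0<τ = proj₁ (proj₂ inv)
    9κτ≡1 : fromℕ 9 *ℚ κ *ℚ τ ≡ 1ℚ
    9κτ≡1 = proj₂ (proj₂ inv)
    τ≤1 : τ ≤ℚ 1ℚ
    τ≤1 = begin
      τ                        ≡⟨ ℚ.*-identityˡ τ ⟨
      1ℚ *ℚ τ                  ≤⟨ *-monoʳ-≤ (ℚ.<⇒≤ 0<τ) 1≤9κ ⟩
      fromℕ 9 *ℚ κ *ℚ τ        ≡⟨ 9κτ≡1 ⟩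
      1ℚ                       ∎
    contraction : ∀ {N} .{{_ : NonZero N}} (G : Graph N D) (C : Graph D 2) → IsCycle C → Contracts G r →
      ∀ a → ∑[ w < N ℕ.* D ] sq (average (replacementProduct G C) a w) ≤ℚ
            (1ℚ -ℚ τ) *ℚ ∑[ w < N ℕ.* D ] sq (a w) +ℚ sq (∑ a)
    contraction {N} G C cycle contracts a = ℚ.*-cancelˡ-≤-pos (fromℕ 9) (begin
      fromℕ 9 *ℚ X
        ≡⟨ solve 2 (λ x e → x := x :+ e :- e) refl (fromℕ 9 *ℚ X) e ⟩
      fromℕ 9 *ℚ X +ℚ e -ℚ e
        ≡⟨ cong (λ z → z -ℚ e) (average-energy (replacementProduct G C) a) ⟩
      fromℕ 9 *ℚ A -ℚ e
        -- The part `8 S` of the slack raises the coefficient of `S` from 1 to 9, so that the common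
        -- factor 9 cancels.
        ≤⟨ ≤-by-difference (e +ℚ S -ℚ fromℕ 9 *ℚ τ *ℚ A +ℚ fromℕ 8 *ℚ S) (+-nonneg gap (*-nonneg (fromℕ-nonneg 8) (sq-nonneg (∑ a))))
             (solve 4 (λ A e S t → con (fromℕ 9) :* A :- e :+ (e :+ S :- con (fromℕ 9) :* t :* A :+ con (fromℕ 8) :* S)
                := con (fromℕ 9) :* ((con 1ℚ :- t) :* A :+ S)) refl A e S τ) ⟩
      fromℕ 9 *ℚ ((1ℚ -ℚ τ) *ℚ A +ℚ S) ∎)
      where
      X A e S B : ℚ
      X = ∑[ w < N ℕ.* D ] sq (average (replacementProduct G C) a w)
      A = ∑[ w < N ℕ.* D ] sq (a w)
      e = energy (replacementProduct G C) a
      S = sq (∑ a)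
      B = ∑[ v < N ] sq (total G C cycle a v)
      0≤e : 0ℚ ≤ℚ e
      0≤e = ∑-nonneg (spread-nonneg (replacementProduct G C) a)
      B≤ : B ≤ℚ fromℕ 2 *ℚ (q *ℚ (k *ℚ e) +ℚ S)
      B≤ = begin
        B
          ≤⟨ poincaré G {r = r} 0≤q (ℚ.<⇒≤ 0<1-r) (proj₂ (proj₂ (inverse 0<1-r))) contracts (total G C cycle a) ⟩
        fromℕ 2 *ℚ (q *ℚ dirichlet G (total G C cycle a) +ℚ sq (∑ (total G C cycle a)))
          ≤⟨ *-monoˡ-≤ (fromℕ-nonneg 2) (ℚ.+-mono-≤ (*-monoˡ-≤ 0≤q (dirichlet-total-≤ G C cycle a))
               (ℚ.≤-reflexive (cong sq (sym (∑-combine N a))))) ⟩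
        fromℕ 2 *ℚ (q *ℚ (k *ℚ e) +ℚ S) ∎
      A≤ : A ≤ℚ κ *ℚ (e +ℚ S)
      A≤ = begin
        A
          ≤⟨ norm-≤ G C cycle a ⟩
        fromℕ 2 *ℚ d *ℚ (c *ℚ e +ℚ B)
          ≤⟨ *-monoˡ-≤ (*-nonneg (fromℕ-nonneg 2) 0≤d) (ℚ.+-monoʳ-≤ (c *ℚ e) B≤) ⟩
        fromℕ 2 *ℚ d *ℚ (c *ℚ e +ℚ fromℕ 2 *ℚ (q *ℚ (k *ℚ e) +ℚ S))
          ≤⟨ ≤-by-difference ((fromℕ 4 *ℚ d +ℚ 1ℚ) *ℚ e +ℚ (m +ℚ 1ℚ) *ℚ S)
               (+-nonneg (*-nonneg (+-nonneg (*-nonneg (fromℕ-nonneg 4) 0≤d) (fromℕ-nonneg 1)) 0≤e)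
                         (*-nonneg (+-nonneg 0≤m (fromℕ-nonneg 1)) (sq-nonneg (∑ a))))
               (solve 6 (λ d c q k e S →
                  con (fromℕ 2) :* d :* (c :* e :+ con (fromℕ 2) :* (q :* (k :* e) :+ S))
                    :+ ((con (fromℕ 4) :* d :+ con 1ℚ) :* e :+ (con (fromℕ 2) :* d :* (c :+ con (fromℕ 2) :* q :* k) :+ con 1ℚ) :* S)
                  := (con (fromℕ 2) :* d :* (c :+ con (fromℕ 2) :* q :* k) :+ con (fromℕ 4) :* d :+ con 1ℚ) :* (e :+ S))
                  refl d c q k e S) ⟩
        κ *ℚ (e +ℚ S) ∎
      gap : 0ℚ ≤ℚ e +ℚ S -ℚ fromℕ 9 *ℚ τ *ℚ A
      gap = begin
        0ℚ                                                         ≡⟨ ℚ.+-inverseʳ (e +ℚ S) ⟨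
        e +ℚ S -ℚ (e +ℚ S)                                         ≡⟨ cong (λ z → e +ℚ S -ℚ z) (ℚ.*-identityˡ (e +ℚ S)) ⟨
        e +ℚ S -ℚ 1ℚ *ℚ (e +ℚ S)                                   ≡⟨ cong (λ z → e +ℚ S -ℚ z *ℚ (e +ℚ S)) 9κτ≡1 ⟨
        e +ℚ S -ℚ fromℕ 9 *ℚ κ *ℚ τ *ℚ (e +ℚ S)                    ≡⟨ cong (λ z → e +ℚ S -ℚ z)
                                                                        (solve 3 (λ κ t y → con (fromℕ 9) :* κ :* t :* y
                                                                          := con (fromℕ 9) :* t :* (κ :* y)) refl κ τ (e +ℚ S)) ⟩
        e +ℚ S -ℚ fromℕ 9 *ℚ τ *ℚ (κ *ℚ (e +ℚ S))                  ≤⟨ ℚ.+-monoʳ-≤ (e +ℚ S) (ℚ.neg-antimono-≤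
                                                                        (*-monoˡ-≤ (*-nonneg (fromℕ-nonneg 9) (ℚ.<⇒≤ 0<τ)) A≤)) ⟩
        e +ℚ S -ℚ fromℕ 9 *ℚ τ *ℚ A                                ∎

-- Passage between rational and real vectors

-- If `q < p`, a point `m` strictly between them makes `ε = min (m - q, 1)` contradict the
-- hypothesis. The restriction to `ε ≤ 1` lets quadratic error terms be bounded by linear ones.
≤-by-ε : ∀ {p q} → (∀ ε → 0ℚ <ℚ ε → ε ≤ℚ 1ℚ → p ≤ℚ q +ℚ ε) → p ≤ℚ q
≤-by-ε {p} {q} h = ℚ.≮⇒≥ λ q<p →
  let m , q<m , m<p = ℚ.<-dense q<p
      ε = (m -ℚ q) ℚ.⊓ 1ℚ
      0<m-q = subst (_<ℚ m -ℚ q) (ℚ.+-inverseʳ q) (ℚ.+-monoˡ-< (-ℚ q) q<m)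
      0<ε = [ (λ eq → subst (0ℚ <ℚ_) (sym eq) 0<m-q) , (λ eq → subst (0ℚ <ℚ_) (sym eq) (ℚ.positive⁻¹ 1ℚ)) ]′
              (ℚ.⊓-sel (m -ℚ q) 1ℚ)
  in ℚ.<-irrefl refl (begin-strict
    p                 ≤⟨ h ε 0<ε (ℚ.p⊓q≤q (m -ℚ q) 1ℚ) ⟩
    q +ℚ ε            ≤⟨ ℚ.+-monoʳ-≤ q (ℚ.p⊓q≤p (m -ℚ q) 1ℚ) ⟩
    q +ℚ (m -ℚ q)     ≡⟨ solve 2 (λ q m → q :+ (m :- q) := m) refl q m ⟩
    m                 <⟨ m<p ⟩
    p                 ∎)
  where
  open ℚ.≤-Reasoning
  open +-*-Solver

fromℚ-reflects-≤ : ∀ {p q} → fromℚ p ≤ fromℚ q → p ≤ℚ q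
fromℚ-reflects-≤ h = ≤-by-ε λ ε 0<ε _ → let N , p≤q+ε = h ε 0<ε in p≤q+ε N ℕ.≤-refl

seq-sum : ∀ {n} (f : Fin n → ℝ) k → seq (sum f) k ≡ ∑[ i < n ] seq (f i) k
seq-sum {zero}  f k = refl
seq-sum {suc n} f k = cong (seq (f zero) k +ℚ_) (seq-sum (f ∘ suc) k)

-- The `n`-th term of the square root of a real whose own `n`-th term is `x`.
root : ℚ → ℕ → ℚ
root x n = lower (clip x) n

seq-norm : ∀ {N} (α : Fin N → ℝ) n (a : Fin N → ℚ) → (∀ v → seq (α v) n ≡ a v) →
  seq ‖ α ‖ n ≡ root (∑[ v < N ] sq (a v)) n
seq-norm α n a α≡a = cong (λ x → root x n) (trans (seq-sum (λ v → α v * α v) n) (sum-cong-≗ λ v → cong sq (α≡a v)))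

seq-·𝟙 : ∀ {N} (α : Fin N → ℝ) n → seq (α · 𝟙) n ≡ ∑[ v < N ] seq (α v) n
seq-·𝟙 α n = trans (seq-sum (λ v → α v * 𝟙 v) n) (sum-cong-≗ λ v → ℚ.*-identityʳ (seq (α v) n))

seq-*ᵥ : ∀ {N} (M : Matrix N) (α : Fin N → ℝ) u n →
  seq ((M *ᵥ α) u) n ≡ ∑[ v < N ] (seq (M u v) n *ℚ seq (α v) n)
seq-*ᵥ M α u n = seq-sum (λ v → M u v * α v) n

-- At a single large index `n`, the bisection bounds turn the inequality of norms into
-- `√X ≤ ρ s + η` with `s² ≤ Y`. Squaring costs at most `b η`, which is made equal to the given `ε`.
constant-norm-≤ : ∀ {N} {ℓ ρ} {α β : Fin N → ℝ} {f g : Fin N → ℚ} →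
  0ℚ ≤ℚ ρ → ρ ≤ℚ 1ℚ → (Eventually λ n → seq ℓ n ≤ℚ ρ) →
  (∀ v n → seq (α v) n ≡ f v) → (∀ v n → seq (β v) n ≡ g v) → ‖ β ‖ ≤ ℓ * ‖ α ‖ →
  ∑[ v < N ] sq (g v) ≤ℚ sq ρ *ℚ ∑[ v < N ] sq (f v)
constant-norm-≤ {N} {ℓ} {ρ} {α} {β} {f} {g} 0≤ρ ρ≤1 (K , ℓ≤ρ) α≡f β≡g ‖β‖≤ℓ‖α‖ = ≤-by-ε close
  where
  open ℚ.≤-Reasoning
  open +-*-Solver
  X Y b : ℚ
  X = ∑[ v < N ] sq (g v)
  Y = ∑[ v < N ] sq (f v)
  -- An upper bound for `2 ρ s + η`, since `ρ s ≤ Y + 1` and `η ≤ 1`.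
  b = fromℕ 2 *ℚ (Y +ℚ 1ℚ) +ℚ 1ℚ
  0≤Y : 0ℚ ≤ℚ Y
  0≤Y = ∑-nonneg (sq-nonneg ∘ f)
  0≤b-1 : 0ℚ ≤ℚ fromℕ 2 *ℚ (Y +ℚ 1ℚ)
  0≤b-1 = *-nonneg (fromℕ-nonneg 2) (+-nonneg 0≤Y (fromℕ-nonneg 1))
  close : ∀ ε → 0ℚ <ℚ ε → ε ≤ℚ 1ℚ → X ≤ℚ sq ρ *ℚ Y +ℚ ε
  close ε 0<ε ε≤1 = begin
    X                                   ≤⟨ ℚ.p≤p⊔q X 0ℚ ⟩
    clip X                              ≤⟨ ℚ.<⇒≤ (upper² (clip-nonneg X) n) ⟩
    sq (root X n +ℚ w)                  ≤⟨ *-mono-≤ 0≤u 0≤t u≤t u≤t ⟩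
    sq (ρ *ℚ s +ℚ η)
      ≡⟨ solve 3 (λ r s e → (r :* s :+ e) :* (r :* s :+ e)
           := r :* r :* (s :* s) :+ e :* (con (fromℕ 2) :* (r :* s) :+ e)) refl ρ s η ⟩
    sq ρ *ℚ sq s +ℚ η *ℚ (fromℕ 2 *ℚ (ρ *ℚ s) +ℚ η)
      ≤⟨ ℚ.+-mono-≤ (*-monoˡ-≤ (sq-nonneg ρ) s²≤Y)
           (*-monoˡ-≤ (ℚ.<⇒≤ 0<η) (ℚ.+-mono-≤ (*-monoˡ-≤ (fromℕ-nonneg 2) ρs≤Y+1) η≤1)) ⟩
    sq ρ *ℚ Y +ℚ η *ℚ b                 ≡⟨ cong (sq ρ *ℚ Y +ℚ_) (trans (ℚ.*-comm η b) bη≡ε) ⟩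
    sq ρ *ℚ Y +ℚ ε                      ∎
    where
    quotient : ∃ λ η → 0ℚ <ℚ η × b *ℚ η ≡ ε
    quotient = divide 0<ε (+1-pos 0≤b-1)
    η : ℚ
    η = proj₁ quotient
    0<η : 0ℚ <ℚ η
    0<η = proj₁ (proj₂ quotient)
    bη≡ε : b *ℚ η ≡ ε
    bη≡ε = proj₂ (proj₂ quotient)
    η≤1 : η ≤ℚ 1ℚ
    η≤1 = begin
      η           ≡⟨ ℚ.*-identityˡ η ⟨
      1ℚ *ℚ η     ≤⟨ *-monoʳ-≤ {r = η} {p = 1ℚ} (ℚ.<⇒≤ 0<η) (≤-by-difference (fromℕ 2 *ℚ (Y +ℚ 1ℚ)) 0≤b-1
                       (ℚ.+-comm 1ℚ (fromℕ 2 *ℚ (Y +ℚ 1ℚ)))) ⟩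
      b *ℚ η      ≡⟨ bη≡ε ⟩
      ε           ≤⟨ ε≤1 ⟩
      1ℚ          ∎
    bounded : Eventually λ n → seq ‖ β ‖ n ≤ℚ seq (ℓ * ‖ α ‖) n +ℚ ½ *ℚ η
    bounded = ‖β‖≤ℓ‖α‖ (½ *ℚ η) (half-pos 0<η)
    thin : ∃ λ M → ∀ q → 0ℚ ≤ℚ q → q ≤ℚ clip X +ℚ 1ℚ → ∀ n → M ℕ.≤ n → width q n ≤ℚ ½ *ℚ η
    -- Half of `η` is spent on the bisection width, half on the inequality of norms. The added 1
    -- makes the bound positive, as `width-small` requires.
    thin = width-small (clip X +ℚ 1ℚ) (½ *ℚ η) (+1-pos (clip-nonneg X)) (half-pos 0<η)
    L M n : ℕ
    L = proj₁ bounded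
    M = proj₁ thin
    n = K ℕ.⊔ (L ℕ.⊔ M)
    s w : ℚ
    s = root Y n
    w = width (clip X) n
    0≤s : 0ℚ ≤ℚ s
    0≤s = lower-nonneg (clip-nonneg Y) n
    0≤u : 0ℚ ≤ℚ root X n +ℚ w
    0≤u = +-nonneg (lower-nonneg (clip-nonneg X) n) (ℚ.<⇒≤ (width-pos (clip-nonneg X) n))
    0≤t : 0ℚ ≤ℚ ρ *ℚ s +ℚ η
    0≤t = +-nonneg (*-nonneg 0≤ρ 0≤s) (ℚ.<⇒≤ 0<η)
    s²≤Y : sq s ≤ℚ Y
    s²≤Y = ℚ.≤-trans (lower² (clip-nonneg Y) n) (ℚ.⊔-lub ℚ.≤-refl 0≤Y)
    s≤Y+1 : s ≤ℚ Y +ℚ 1ℚ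
    s≤Y+1 = square-cancel-≤ (+-nonneg 0≤Y (fromℕ-nonneg 1)) (ℚ.≤-trans s²≤Y
      (≤-by-difference (sq Y +ℚ Y +ℚ 1ℚ) (+-nonneg (+-nonneg (sq-nonneg Y) 0≤Y) (fromℕ-nonneg 1))
        (solve 1 (λ y → y :+ (y :* y :+ y :+ con 1ℚ) := (y :+ con 1ℚ) :* (y :+ con 1ℚ)) refl Y)))
    ρs≤Y+1 : ρ *ℚ s ≤ℚ Y +ℚ 1ℚ
    ρs≤Y+1 = ℚ.≤-trans (*-monoʳ-≤ 0≤s ρ≤1) (ℚ.≤-trans (ℚ.≤-reflexive (ℚ.*-identityˡ s)) s≤Y+1)
    K≤n : K ℕ.≤ n
    K≤n = proj₁ (both {K} {L ℕ.⊔ M} ℕ.≤-refl)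
    L≤n×M≤n : L ℕ.≤ n × M ℕ.≤ n
    L≤n×M≤n = both {L} {M} (proj₂ (both {K} {L ℕ.⊔ M} ℕ.≤-refl))
    u≤t : root X n +ℚ w ≤ℚ ρ *ℚ s +ℚ η
    u≤t = begin
      root X n +ℚ w
        ≡⟨ cong (_+ℚ w) (seq-norm β n g (λ v → β≡g v n)) ⟨
      (seq ‖ β ‖ n) +ℚ w
        ≤⟨ ℚ.+-mono-≤ (proj₂ bounded n (proj₁ L≤n×M≤n))
             (proj₂ thin (clip X) (clip-nonneg X) (≤-by-difference 1ℚ (fromℕ-nonneg 1) refl) n (proj₂ L≤n×M≤n)) ⟩
      seq ℓ n *ℚ (seq ‖ α ‖ n) +ℚ ½ *ℚ η +ℚ ½ *ℚ η
        ≡⟨ trans (ℚ.+-assoc (seq ℓ n *ℚ (seq ‖ α ‖ n)) (½ *ℚ η) (½ *ℚ η))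
             (cong₂ (λ y z → seq ℓ n *ℚ y +ℚ z) (seq-norm α n f (λ v → α≡f v n)) (half+half η)) ⟩
      seq ℓ n *ℚ s +ℚ η
        ≤⟨ ℚ.+-monoˡ-≤ η (*-monoʳ-≤ 0≤s (ℓ≤ρ n K≤n)) ⟩
      ρ *ℚ s +ℚ η ∎

-- For large `n` the sum of the approximations is at most `δ` in absolute value, so `sq (root X n) ≤
-- ρ² (s + w)² + δ² ≤ (ρ (s + w) + δ)²`. Taking roots leaves the errors `ρ w ≤
-- δ` and `δ`, together `ε`.
norm-≤-by-contraction : ∀ {N} {μ ρ} {α β : Fin N → ℝ} (g : ℕ → Fin N → ℚ) → 0ℚ ≤ℚ ρ → ρ ≤ℚ 1ℚ → μ ≤ℚ sq ρ →
  (∀ v n → seq (β v) n ≡ g n v) →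
  (∀ n → ∑[ v < N ] sq (g n v) ≤ℚ μ *ℚ ∑[ v < N ] sq (seq (α v) n) +ℚ sq (∑[ v < N ] seq (α v) n)) →
  α · 𝟙 ≃ 0ℝ → ‖ β ‖ ≤ fromℚ ρ * ‖ α ‖
norm-≤-by-contraction {N} {μ} {ρ} {α} {β} g 0≤ρ ρ≤1 μ≤ρ² β≡g contraction (·𝟙≤0 , 0≤·𝟙) ε 0<ε =
  (J ℕ.⊔ K) ℕ.⊔ (L ℕ.⊔ M) , λ n le →
    let J≤n , K≤n = both {J} {K} (proj₁ (both {J ℕ.⊔ K} {L ℕ.⊔ M} le))
        L≤n , M≤n = both {L} {M} (proj₂ (both {J ℕ.⊔ K} {L ℕ.⊔ M} le))
    in at n (proj₂ above n J≤n) (proj₂ below n K≤n)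
         (proj₂ thin (clip (Y n)) (clip-nonneg (Y n))
           (ℚ.≤-trans (clip≤∣∣ (Y n)) (subst (λ y → ℚ.∣ y ∣ ≤ℚ proj₁ bounded)
             (seq-sum (λ v → α v * α v) n) (proj₂ (proj₂ (proj₂ bounded)) n L≤n))) n M≤n)
  where
  open ℚ.≤-Reasoning
  open +-*-Solver
  δ : ℚ
  δ = ½ *ℚ ε
  0<δ : 0ℚ <ℚ δ
  0<δ = half-pos 0<ε
  a : ℕ → Fin N → ℚ
  a n v = seq (α v) n
  Y : ℕ → ℚ
  Y n = ∑[ v < N ] sq (a n v)
  above : Eventually λ n → seq (α · 𝟙) n ≤ℚ 0ℚ +ℚ δ
  above = ·𝟙≤0 δ 0<δ
  below : Eventually λ n → 0ℚ ≤ℚ seq (α · 𝟙) n +ℚ δ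
  below = 0≤·𝟙 δ 0<δ
  bounded : ∃ λ B → 0ℚ <ℚ B × Eventually λ n → ℚ.∣ seq (α · α) n ∣ ≤ℚ B
  bounded = eventually-bounded (α · α)
  thin : ∃ λ M → ∀ q → 0ℚ ≤ℚ q → q ≤ℚ proj₁ bounded → ∀ n → M ℕ.≤ n → width q n ≤ℚ δ
  thin = width-small (proj₁ bounded) δ (proj₁ (proj₂ bounded)) 0<δ
  J K L M : ℕ
  J = proj₁ above
  K = proj₁ below
  L = proj₁ (proj₂ (proj₂ bounded))
  M = proj₁ thin

  at : ∀ n → seq (α · 𝟙) n ≤ℚ 0ℚ +ℚ δ → 0ℚ ≤ℚ seq (α · 𝟙) n +ℚ δ → width (clip (Y n)) n ≤ℚ δ →
    seq ‖ β ‖ n ≤ℚ seq (fromℚ ρ * ‖ α ‖) n +ℚ ε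
  at n σ≤0+δ 0≤σ+δ w≤δ = begin
    (seq ‖ β ‖ n)  ≡⟨ seq-norm β n (g n) (λ v → β≡g v n) ⟩
    root X n                      ≤⟨ square-cancel-≤ 0≤t squares ⟩
    ρ *ℚ (s +ℚ w) +ℚ δ            ≡⟨ cong (_+ℚ δ) (ℚ.*-distribˡ-+ ρ s w) ⟩
    ρ *ℚ s +ℚ ρ *ℚ w +ℚ δ         ≤⟨ ℚ.+-monoˡ-≤ δ (ℚ.+-monoʳ-≤ (ρ *ℚ s) ρw≤δ) ⟩
    ρ *ℚ s +ℚ δ +ℚ δ              ≡⟨ trans (ℚ.+-assoc (ρ *ℚ s) δ δ)
                                     (cong₂ _+ℚ_ (cong (ρ *ℚ_) (sym (seq-norm α n (λ v → seq (α v) n) (λ _ → refl)))) (half+half ε)) ⟩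
    ρ *ℚ (seq ‖ α ‖ n) +ℚ ε         ∎
    where
    X σ s w : ℚ
    X = ∑[ v < N ] sq (g n v)
    σ = ∑ (a n)
    s = root (Y n) n
    w = width (clip (Y n)) n
    σ≤δ : σ ≤ℚ δ
    σ≤δ = subst (σ ≤ℚ_) (ℚ.+-identityˡ δ) (subst (_≤ℚ 0ℚ +ℚ δ) (seq-·𝟙 α n) σ≤0+δ)
    0≤w : 0ℚ ≤ℚ w
    0≤w = ℚ.<⇒≤ (width-pos (clip-nonneg (Y n)) n)
    0≤s : 0ℚ ≤ℚ s
    0≤s = lower-nonneg (clip-nonneg (Y n)) n
    0≤t : 0ℚ ≤ℚ ρ *ℚ (s +ℚ w) +ℚ δ
    0≤t = +-nonneg (*-nonneg 0≤ρ (+-nonneg 0≤s 0≤w)) (ℚ.<⇒≤ 0<δ)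
    ρw≤δ : ρ *ℚ w ≤ℚ δ
    ρw≤δ = ℚ.≤-trans (*-monoʳ-≤ 0≤w ρ≤1) (ℚ.≤-trans (ℚ.≤-reflexive (ℚ.*-identityˡ w)) w≤δ)
    σ²≤δ² : sq σ ≤ℚ sq δ
    σ²≤δ² = ≤-by-difference ((δ -ℚ σ) *ℚ (σ +ℚ δ))
      (*-nonneg (subst (_≤ℚ δ -ℚ σ) (ℚ.+-inverseʳ σ) (ℚ.+-monoˡ-≤ (-ℚ σ) σ≤δ))
                (subst (λ z → 0ℚ ≤ℚ z +ℚ δ) (seq-·𝟙 α n) 0≤σ+δ))
      (solve 2 (λ s d → s :* s :+ (d :- s) :* (s :+ d) := d :* d) refl σ δ)
    squares : sq (root X n) ≤ℚ sq (ρ *ℚ (s +ℚ w) +ℚ δ)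
    squares = begin
      sq (root X n)                              ≤⟨ lower² (clip-nonneg X) n ⟩
      clip X                                     ≤⟨ ℚ.⊔-lub ℚ.≤-refl (∑-nonneg (sq-nonneg ∘ g n)) ⟩
      X                                          ≤⟨ contraction n ⟩
      μ *ℚ Y n +ℚ sq σ                           ≤⟨ ℚ.+-mono-≤ (*-monoʳ-≤ (∑-nonneg (sq-nonneg ∘ a n)) μ≤ρ²) σ²≤δ² ⟩
      sq ρ *ℚ Y n +ℚ sq δ                        ≤⟨ ℚ.+-monoˡ-≤ (sq δ) (*-monoˡ-≤ (sq-nonneg ρ)
                                                      (ℚ.≤-trans (ℚ.p≤p⊔q (Y n) 0ℚ) (ℚ.<⇒≤ (upper² (clip-nonneg (Y n)) n)))) ⟩
      sq ρ *ℚ sq (s +ℚ w) +ℚ sq δ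
        ≤⟨ ≤-by-difference (fromℕ 2 *ℚ (ρ *ℚ (s +ℚ w)) *ℚ δ)
             (*-nonneg (*-nonneg (fromℕ-nonneg 2) (*-nonneg 0≤ρ (+-nonneg 0≤s 0≤w))) (ℚ.<⇒≤ 0<δ))
             (solve 3 (λ r y d → r :* r :* (y :* y) :+ d :* d :+ con (fromℕ 2) :* (r :* y) :* d
                := (r :* y :+ d) :* (r :* y :+ d)) refl ρ (s +ℚ w) δ) ⟩
      sq (ρ *ℚ (s +ℚ w) +ℚ δ)                    ∎

-- Left implicit, the instance arguments of adjacency would make the comparison of reals unfold
-- their Cauchy proofs.
module _ {N D} .{{nz : NonZero D}} (G : Graph N D) where

  seq-adjacency : ∀ (α : Fin N → ℝ) u n →
    seq ((adjacency G *ᵥ α) u) n ≡ average G (λ w → seq (α w) n) u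
  seq-adjacency α u n = trans (seq-*ᵥ (adjacency {N} {D} {{nz}} G) α u n)
    (sum-cong-≗ {N} {λ v → seq (adjacency G u v) n *ℚ seq (α v) n}
      {λ v → (ℤ.+ edgeCount G u v ℚ./ D) *ℚ seq (α v) n} λ v → refl)

  -- `IsExpander` speaks of vectors that are not zero. The goal is a decidable inequality of
  -- rationals, so its negation may be assumed; this excludes `α ≋ 𝟘`, for which the goal holds
  -- trivially.
  expander⇒contracts : ∀ {ℓ ρ} → 0ℚ ≤ℚ ρ → ρ ≤ℚ 1ℚ → (Eventually λ n → seq ℓ n ≤ℚ ρ) →
    IsExpander G ℓ → Contracts G (sq ρ)
  expander⇒contracts {ℓ} {ρ} 0≤ρ ρ≤1 ℓ≤ρ expander f ∑f≡0 =
    decidable-stable (X ℚ.≤? sq ρ *ℚ Y) λ X≰ρ²Y → X≰ρ²Y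
      (constant-norm-≤ {ℓ = ℓ} {α = α} {β = adjacency {N} {D} {{nz}} G *ᵥ α} 0≤ρ ρ≤1 ℓ≤ρ (λ _ _ → refl) (λ v n → seq-adjacency α v n)
        (bound {N} {D} {{nz}} expander α orthogonal λ α≋𝟘 → X≰ρ²Y (trivial α≋𝟘)))
    where
    open ℚ.≤-Reasoning
    open +-*-Solver
    α : Fin N → ℝ
    α = fromℚ ∘ f
    X Y : ℚ
    X = ∑[ v < N ] sq (average G f v)
    Y = ∑[ v < N ] sq (f v)
    0≤Y : 0ℚ ≤ℚ Y
    0≤Y = ∑-nonneg (sq-nonneg ∘ f)

    trivial : α ≋ 𝟘 → X ≤ℚ sq ρ *ℚ Y
    trivial α≋𝟘 = begin
      X               ≡⟨ sum-cong-≗ (λ v → cong sq (average≡0 v)) ⟩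
      ∑[ v < N ] 0ℚ   ≡⟨ sum-replicate-zero N ⟩
      0ℚ              ≤⟨ *-nonneg (sq-nonneg ρ) 0≤Y ⟩
      sq ρ *ℚ Y       ∎
      where
      average≡0 : ∀ u → average G f u ≡ 0ℚ
      average≡0 u = trans
        (sum-cong-≗ λ v → trans
          (cong (λ x → (ℤ.+ edgeCount G u v ℚ./ D) *ℚ x)
            (ℚ.≤-antisym (fromℚ-reflects-≤ (proj₁ (α≋𝟘 v))) (fromℚ-reflects-≤ (proj₂ (α≋𝟘 v)))))
          (ℚ.*-zeroʳ (ℤ.+ edgeCount G u v ℚ./ D)))
        (sum-replicate-zero N)

    orthogonal : α · 𝟙 ≃ 0ℝ
    orthogonal = (λ ε 0<ε → 0 , λ n _ → begin
        seq (α · 𝟙) n     ≡⟨ trans (seq-·𝟙 α n) ∑f≡0 ⟩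
        0ℚ                ≤⟨ ℚ.<⇒≤ 0<ε ⟩
        ε                 ≡⟨ ℚ.+-identityˡ ε ⟨
        0ℚ +ℚ ε           ∎)
      , (λ ε 0<ε → 0 , λ n _ → begin
        0ℚ                     ≤⟨ ℚ.<⇒≤ 0<ε ⟩
        ε                      ≡⟨ ℚ.+-identityˡ ε ⟨
        0ℚ +ℚ ε                ≡⟨ cong (_+ℚ ε) (trans (seq-·𝟙 α n) ∑f≡0) ⟨
        seq (α · 𝟙) n +ℚ ε     ∎)

  contraction⇒bound : ∀ {μ ρ} → 0ℚ ≤ℚ ρ → ρ ≤ℚ 1ℚ → μ ≤ℚ sq ρ →
    (∀ a → ∑[ v < N ] sq (average G a v) ≤ℚ μ *ℚ ∑[ v < N ] sq (a v) +ℚ sq (∑ a)) →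
    ∀ α → α · 𝟙 ≃ 0ℝ → ‖ adjacency G *ᵥ α ‖ ≤ fromℚ ρ * ‖ α ‖
  contraction⇒bound 0≤ρ ρ≤1 μ≤ρ² contraction α =
    norm-≤-by-contraction {α = α} {β = adjacency {N} {D} {{nz}} G *ᵥ α} (λ n → average {N} {D} {{nz}} G (λ v → seq (α v) n))
      0≤ρ ρ≤1 μ≤ρ² (λ v n → seq-adjacency α v n) (λ n → contraction (λ v → seq (α v) n))

-- From the rational contraction rate to the bound on the second eigenvalue

corollary6p5 : ∀ (ℓ : ℝ) → ℓ < 1ℝ → ∀ (D : ℕ) .{{_ : NonZero D}} → ¬ (2 ∣ D) →
    ∃ λ (ℓ′ : ℝ) → ℓ′ < 1ℝ ×
    (∀ (N : ℕ) .{{_ : NonZero N}} (G : Graph N D) (C : Graph D 2) →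
    IsExpander G ℓ → IsCycle C → IsExpander (replacementProduct G C) ℓ′)
corollary6p5 ℓ (ε , 0<ε , K , ℓ+ε≤1) D 2∤D =
  fromℚ ρ′ , (½ *ℚ τ , half-pos 0<τ , 0 , λ _ _ → ℚ.≤-reflexive ρ′+½τ≡1) , λ N G C expander cycle → record
    { one-vertex = λ _ η 0<η → 0 , λ _ _ → +-nonneg 0≤ρ′ (ℚ.<⇒≤ 0<η)
    ; bound      = λ α α⊥𝟙 _ → contraction⇒bound (replacementProduct G C) 0≤ρ′ ρ′≤1 1-τ≤ρ′²
        (contraction G C cycle (expander⇒contracts G 0≤ρ (ℚ.<⇒≤ ρ<1) (K , ℓ≤ρ) expander)) α α⊥𝟙
    }
  where
  open ℚ.≤-Reasoning
  open +-*-Solver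
  ρ : ℚ
  -- Eventually `ℓ` is at most `1 - ε`; clipping at 0 keeps `ρ` nonnegative when `ε` exceeds 1.
  ρ = clip (1ℚ -ℚ ε)
  0≤ρ : 0ℚ ≤ℚ ρ
  0≤ρ = clip-nonneg (1ℚ -ℚ ε)
  1-ε<1 : 1ℚ -ℚ ε <ℚ 1ℚ
  1-ε<1 = subst (1ℚ -ℚ ε <ℚ_) (ℚ.+-identityʳ 1ℚ) (ℚ.+-monoʳ-< 1ℚ (ℚ.neg-antimono-< 0<ε))
  ρ<1 : ρ <ℚ 1ℚ
  ρ<1 = [ (λ eq → subst (_<ℚ 1ℚ) (sym eq) 1-ε<1) , (λ eq → subst (_<ℚ 1ℚ) (sym eq) (ℚ.positive⁻¹ 1ℚ)) ]′
    (ℚ.⊔-sel (1ℚ -ℚ ε) 0ℚ)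
  ℓ≤ρ : ∀ n → K ℕ.≤ n → seq ℓ n ≤ℚ ρ
  ℓ≤ρ n K≤n = begin
    seq ℓ n                  ≡⟨ solve 2 (λ x e → x := x :+ e :- e) refl (seq ℓ n) ε ⟩
    seq ℓ n +ℚ ε -ℚ ε        ≤⟨ ℚ.+-monoˡ-≤ (-ℚ ε) (ℓ+ε≤1 n K≤n) ⟩
    1ℚ -ℚ ε                  ≤⟨ ℚ.p≤p⊔q (1ℚ -ℚ ε) 0ℚ ⟩
    ρ                        ∎
  ρ²<1 : sq ρ <ℚ 1ℚ
  ρ²<1 = ℚ.≤-<-trans (ℚ.≤-trans (*-monoˡ-≤ 0≤ρ (ℚ.<⇒≤ ρ<1)) (ℚ.≤-reflexive (ℚ.*-identityʳ ρ))) ρ<1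
  τ ρ′ : ℚ
  τ = proj₁ (Replacement.replacement-contraction 2∤D ρ²<1)
  -- A rational upper bound for the square root of `1 - τ`: its square is `1 - τ` plus the square of
  -- `τ / 2`. The gap `τ / 2` also witnesses that it lies below 1.
  ρ′ = 1ℚ -ℚ ½ *ℚ τ
  0<τ : 0ℚ <ℚ τ
  0<τ = proj₁ (proj₂ (Replacement.replacement-contraction 2∤D ρ²<1))
  τ≤1 : τ ≤ℚ 1ℚ
  τ≤1 = proj₁ (proj₂ (proj₂ (Replacement.replacement-contraction 2∤D ρ²<1)))
  contraction : ∀ {N} .{{_ : NonZero N}} (G : Graph N D) (C : Graph D 2) → IsCycle C → Contracts G (sq ρ) →
    ∀ a → ∑[ w < N ℕ.* D ] sq (average (replacementProduct G C) a w) ≤ℚ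
          (1ℚ -ℚ τ) *ℚ ∑[ w < N ℕ.* D ] sq (a w) +ℚ sq (∑ a)
  contraction = proj₂ (proj₂ (proj₂ (Replacement.replacement-contraction 2∤D ρ²<1)))
  ρ′+½τ≡1 : ρ′ +ℚ ½ *ℚ τ ≡ 1ℚ
  ρ′+½τ≡1 = solve 1 (λ t → con 1ℚ :- con ½ :* t :+ con ½ :* t := con 1ℚ) refl τ
  ρ′≤1 : ρ′ ≤ℚ 1ℚ
  ρ′≤1 = ≤-by-difference (½ *ℚ τ) (ℚ.<⇒≤ (half-pos 0<τ)) ρ′+½τ≡1
  0≤ρ′ : 0ℚ ≤ℚ ρ′
  0≤ρ′ = begin
    0ℚ                          ≤⟨ +-nonneg (subst (_≤ℚ 1ℚ -ℚ τ) (ℚ.+-inverseʳ τ) (ℚ.+-monoˡ-≤ (-ℚ τ) τ≤1)) (ℚ.<⇒≤ (half-pos 0<τ)) ⟩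
    1ℚ -ℚ τ +ℚ ½ *ℚ τ           ≡⟨ solve 1 (λ t → con 1ℚ :- t :+ con ½ :* t := con 1ℚ :- con ½ :* t) refl τ ⟩
    ρ′                          ∎
  1-τ≤ρ′² : 1ℚ -ℚ τ ≤ℚ sq ρ′
  1-τ≤ρ′² = ≤-by-difference (sq (½ *ℚ τ)) (sq-nonneg (½ *ℚ τ))
    (solve 1 (λ t → con 1ℚ :- t :+ con ½ :* t :* (con ½ :* t)
      := (con 1ℚ :- con ½ :* t) :* (con 1ℚ :- con ½ :* t)) refl τ)
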